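{- There exists a constant $c>0$ such that for every positive integer $m$, the number $\mathcal N$ of straight line drawings $\mathbf v$ of $K_{1,2m,2m}$ on $P=\{ -2m,-2m+1,\dots,2m-1,2m\}\subset\mathbb Z$ (dimension $d=1$) which minimize $\lambda(\mathbf v)$ satisfies $$c\,\frac{16^m}{m^5}<\mathcal N<16^m.$$
   Context: $K_{1,2m,2m}$ is the complete tripartite graph with classes $A_1,A_2,A_3$ of sizes $1,2m,2m$. A straight line drawing of a graph $G=(V,E)$ with $N=|P|$ vertices on $P$ places the vertices at pairwise distinct points of $P$ (vertex $i$ at $\vec v_i$); for complete multipartite graphs, such a drawing is identified with the coloring of the points of $P$ by the (labelled) classes, so drawings are counted as ordered triples $(A_1,A_2,A_3)$ of disjoint subsets of $P$ of sizes $1,2m,2m$. For a drawing $\mathbf v$, $$\lambda(\mathbf v)=\frac{\sum_{ij\in E}\|\vec v_i-\vec v_j\|^2}{\sum_{i\in V}\|\vec v_i\|^2}.$$ "Minimize" means minimize over all such drawings. -}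

module Defs where

open import Data.Bool using (if_then_else_)
open import Data.Fin using (Fin; toℕ; _<_)
open import Data.Fin.Properties using (any?; _≟_; _<?_)
open import Data.Fin.Subset using (Subset; _∈_; _∩_; Empty; ∣_∣)
open import Data.Fin.Subset.Properties using (_∈?_)
open import Data.Integer as ℤ using (ℤ; +_)
open import Data.List using (List; length)
open import Data.List.Membership.Propositional using () renaming (_∈_ to _∈ₗ_)
open import Data.List.Relation.Unary.Unique.Propositional using (Unique)
open import Data.Nat using (ℕ; suc; _+_; _*_; _^_; NonZero)
open import Data.Nat.Properties using (+-*-semiring)
open import Algebra.Properties.Semiring.Sum +-*-semiring using (sum-syntax)
open import Data.Product using (_×_; ∃; ∃₂)
open import Data.Rational using (ℚ; _/_; _≤_)
open import Data.Vec using (Vec; []; _∷_; lookup)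
open import Data.Vec.Functional using (Vector)
open import Function.Bundles using (_⇔_)
open import Level using (Level; 0ℓ)
open import Relation.Binary using (Rel; Decidable)
open import Relation.Binary.PropositionalEquality using (_≡_; _≢_)
open import Relation.Nullary using (does; ¬?; _×-dec_)
open import Relation.Unary using (Pred)

private
  variable
    a p : Level
    k n : ℕ

‖_‖² : ℤ → ℕ
‖ x ‖² = ℤ.∣ x ∣ ^ 2

normSum : Vector ℤ n → ℕ
normSum {n} v = ∑[ i < n ] ‖ v i ‖²

-- Each edge of the (symmetric) relation E is counted once, as a pair i < j.
edgeSum : Vector ℤ n → {E : Rel (Fin n) 0ℓ} → Decidable E → ℕ
edgeSum {n} v E? = ∑[ i < n ] ∑[ j < n ]
  (if does ((i <? j) ×-dec E? i j) then ‖ v i ℤ.- v j ‖² else 0)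

-- The ratio λ of the graph with vertices Fin n and edges E, drawn by v.
Λ : (v : Vector ℤ n) .{{_ : NonZero (normSum v)}} →
    {E : Rel (Fin n) 0ℓ} → Decidable E → ℚ
Λ v E? = + edgeSum v E? / normSum v

-- A drawing of the complete multipartite graph with the given class sizes on n
-- points, identified with the labelled colouring of the points by the classes:
-- lookup A r is the set of indices of the points occupied by class r. The sizes
-- are meant to add up to n, so that every point carries a vertex; the drawn
-- graph then has vertex set Fin n and edge relation Adjacent A.
record IsDrawing (sizes : Vec ℕ k) (A : Vec (Subset n) k) : Set where
  field
    cardinality : ∀ r → ∣ lookup A r ∣ ≡ lookup sizes r
    disjoint    : ∀ {r s} → r ≢ s → Empty (lookup A r ∩ lookup A s)

Adjacent : Vec (Subset n) k → Rel (Fin n) 0ℓ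
Adjacent A i j = ∃₂ λ r s → r ≢ s × i ∈ lookup A r × j ∈ lookup A s

adjacent? : (A : Vec (Subset n) k) → Decidable (Adjacent A)
adjacent? A i j = any? λ r → any? λ s →
  ¬? (r ≟ s) ×-dec (i ∈? lookup A r) ×-dec (j ∈? lookup A s)

record IsMinimizer (v : Vector ℤ n) .{{_ : NonZero (normSum v)}}
                   (sizes : Vec ℕ k) (A : Vec (Subset n) k) : Set where
  field
    isDrawing : IsDrawing sizes A
    minimal   : ∀ B → IsDrawing sizes B →
                Λ v (adjacent? A) ≤ Λ v (adjacent? B)

HasCardinality : {X : Set a} → Pred X p → ℕ → Set _
HasCardinality Q N =
  ∃ λ xs → length xs ≡ N × Unique xs × (∀ x → x ∈ₗ xs ⇔ Q x)

-- The points −2m, −2m+1, …, 2m.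
points : (m : ℕ) → Vector ℤ (1 + 4 * m)
points m i = + toℕ i ℤ.- + (2 * m)

normSum-points≢0 : ∀ m .{{_ : NonZero m}} → NonZero (normSum (points m))
normSum-points≢0 (suc m) = _

sizes-K₁,₂ₘ,₂ₘ : ℕ → Vec ℕ 3
sizes-K₁,₂ₘ,₂ₘ m = 1 ∷ 2 * m ∷ 2 * m ∷ []

IsMinimalDrawing : (m : ℕ) .{{_ : NonZero m}} → Vec (Subset (1 + 4 * m)) 3 → Set
IsMinimalDrawing m = IsMinimizer (points m) {{normSum-points≢0 m}} (sizes-K₁,₂ₘ,₂ₘ m)

{-# OPTIONS --safe #-}

-- For the drawing by classes a, b, c on the points v i, with signed sums s_a, s_b, s_c,
-- the variance identity Σ_{i,j} α_i α_j (v_i − v_j)² = 2 (Σ α)(Σ α v²) − 2 (Σ α v)²,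
-- applied to all points (whose sum is 0) and to each class, gives, with k = 2m and x the
-- point of the singleton class,
--   Σ_E ‖v_i − v_j‖² = (k + 1) Σ ‖v_i‖² + (k − 1) x² + s_a² + s_b² + s_c².
-- So the minimal drawings are those with the singleton at 0 and b a k-subset of sum 0.
-- Their number is bounded below by Cauchy–Schwarz in the form: a map from a set S to p
-- values has at least |S|²/p colliding pairs. Pairing a subset of {1,…,m} with the
-- complement of another one of the same cardinality gives at least 4^m/(m + 1)
-- m-subsets of a 2m-set, and pairing such m-subsets of equal index sum, the first one
-- complemented, on the two sides of 0 gives at least (4^m/(m + 1))²/(4m² + 1) sets b.
module Submission where

open import Data.Bool using (true; false; not; if_then_else_)
open import Data.Empty using (⊥-elim)
open import Data.Fin as Fin using (Fin; zero; suc; toℕ)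
open import Data.Fin.Patterns using (0F; 1F; 2F)
import Data.Fin.Properties as Fin
open import Data.Fin.Subset using (Subset; inside; outside; ∣_∣; ∁; ⊥; _∩_; _∈_; Empty)
open import Data.Fin.Subset.Properties using (∣p∣≤n; ∣⊥∣≡0; x∈p∩q⁺; x∈p∩q⁻)
open import Data.Integer as ℤ using (ℤ; +_; -[1+_]; 0ℤ; 1ℤ)
  renaming (_+_ to infixl 6 _+ᶻ_; _-_ to infixl 6 _-ᶻ_; _*_ to infixl 7 _*ᶻ_)
import Data.Integer.Properties as ℤ
import Data.Integer.Tactic.RingSolver as ℤSolver
open import Data.List as List using (List; _∷_; []; length; filter; cartesianProduct)
open import Data.List.Membership.Propositional using (lose) renaming (_∈_ to _∈ₗ_)
open import Data.List.Membership.Propositional.Properties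
  using (∈-++⁺ˡ; ∈-++⁺ʳ; ∈-map⁺; ∈-map⁻; ∈-filter⁺; ∈-filter⁻; ∈-cartesianProduct⁺)
open import Data.List.Properties using (map-++; map-∘; length-++; length-map; filter-notAll)
import Data.List.Relation.Unary.All as All
import Data.List.Relation.Unary.AllPairs as AllPairs
open import Data.List.Relation.Unary.Any using (here)
open import Data.List.Relation.Unary.Unique.Propositional using (Unique)
open import Data.List.Relation.Unary.Unique.Propositional.Properties
  using (++⁺; map⁺; filter⁺; cartesianProduct⁺)
open import Data.Nat
  using (ℕ; zero; suc; _+_; _*_; _^_; _≤_; _<_; z≤n; s≤s; _≟_; NonZero; >-nonZero; ≢-nonZero⁻¹)
open import Data.Nat.ListAction using (sum)
open import Data.Nat.ListAction.Properties using (sum-++)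
open import Data.Nat.Properties
open import Data.Nat.Tactic.RingSolver using (solve-∀)
open import Algebra.Properties.Semiring.Sum +-*-semiring
  using (sum-syntax; ∑-distrib-+; ∑-comm; sum-cong-≋; sum-replicate-zero)
import Algebra.Properties.Semiring.Sum ℤ.+-*-semiring as ℤΣ
open import Data.Product using (∃; ∃₂; ∃-syntax; _×_; _,_; proj₁; proj₂)
open import Data.Rational as ℚ using (0ℚ; _/_)
open import Data.Rational.Properties
  using (toℚᵘ-cancel-≤; toℚᵘ-mono-≤; toℚᵘ-cancel-<; toℚᵘ-fromℚᵘ; toℚᵘ-homo-*)
open import Data.Rational.Unnormalised using (mkℚᵘ; *≤*; *<*)
import Data.Rational.Unnormalised.Properties as ℚᵘ
open import Data.Vec using (Vec; _∷_; []; _++_; lookup)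
open import Data.Vec.Properties
  using (∷-injective; ++-injective; lookup-replicate; []=⇒lookup; lookup⇒[]=)
open import Function using (_∘_)
open import Function.Bundles using (mk⇔)
open import Level using (0ℓ)
open import Relation.Binary using (Rel; Decidable; Symmetric; tri<; tri≈; tri>)
open import Relation.Binary.PropositionalEquality
open import Relation.Nullary using (¬_; Dec; does; yes; no; _×-dec_)
open import Relation.Unary as Unary using (Pred)
open import Defs

private
  variable
    k m n p q : ℕ

-- Indicators, finite sums and the Cauchy-Schwarz inequality.

𝟙 : ∀ {a} {P : Set a} → Dec P → ℕ
𝟙 P? = if does P? then 1 else 0

𝟙-mono : ∀ {a b} {P : Set a} {Q : Set b} (P? : Dec P) (Q? : Dec Q) → (P → Q) → 𝟙 P? ≤ 𝟙 Q?
𝟙-mono (no _)  Q?      f = z≤n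
𝟙-mono (yes p) (yes _) f = s≤s z≤n
𝟙-mono (yes p) (no ¬q) f = ⊥-elim (¬q (f p))

𝟙-*-mono : ∀ {a b c d} {P : Set a} {Q : Set b} {R : Set c} {S : Set d}
  (P? : Dec P) (Q? : Dec Q) (R? : Dec R) (S? : Dec S) →
  (P → Q → R → S) → 𝟙 P? * 𝟙 Q? * 𝟙 R? ≤ 𝟙 S?
𝟙-*-mono (no _)  Q?      R?      S?      f = z≤n
𝟙-*-mono (yes _) (no _)  R?      S?      f = z≤n
𝟙-*-mono (yes _) (yes _) (no _)  S?      f = z≤n
𝟙-*-mono (yes p) (yes q) (yes r) (no ¬s) f = ⊥-elim (¬s (f p q r))
𝟙-*-mono (yes _) (yes _) (yes _) (yes _) f = s≤s z≤n

δ : ℕ → ℕ → ℕ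
δ a b = 𝟙 (a ≟ b)

∑-zero : ∀ n → ∑[ i < n ] 0 ≡ 0
∑-zero = sum-replicate-zero

∑-cong : ∀ n {f g : Fin n → ℕ} → (∀ i → f i ≡ g i) → ∑[ i < n ] f i ≡ ∑[ i < n ] g i
∑-cong n = sum-cong-≋

∑-mono : {f g : Fin n → ℕ} → (∀ i → f i ≤ g i) → ∑[ i < n ] f i ≤ ∑[ i < n ] g i
∑-mono {n = zero}  f≤g = z≤n
∑-mono {n = suc n} f≤g = +-mono-≤ (f≤g zero) (∑-mono (f≤g ∘ suc))

∑-δ : ∀ {a} (g : ℕ → ℕ) → a < n → ∑[ j < n ] (δ a (toℕ j) * g (toℕ j)) ≡ g a
∑-δ {n = suc n} {zero}  g a<n = trans (cong₂ _+_ (*-identityˡ (g 0)) (∑-zero n)) (+-identityʳ (g 0))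
∑-δ {n = suc n} {suc a} g (s≤s a<n) = ∑-δ (g ∘ suc) a<n

-- Induction on `n`: after splitting off `x = a zero`, the mixed term `2 * x * s` is bounded summand
-- by summand through `2xb ≤ x² + b²`.
cauchy-schwarz : ∀ (a : Fin n → ℕ) →
  (∑[ i < n ] a i) * (∑[ i < n ] a i) ≤ n * ∑[ i < n ] (a i * a i)
cauchy-schwarz {zero} a = z≤n
cauchy-schwarz {suc n} a = begin
  (x + s) * (x + s)                   ≡⟨ square x s ⟩
  x * x + 2 * x * s + s * s           ≤⟨ +-mono-≤ (+-monoʳ-≤ (x * x) (mixed n (a ∘ suc))) (cauchy-schwarz (a ∘ suc)) ⟩
  x * x + (n * (x * x) + t) + n * t   ≡⟨ collect n x t ⟩
  suc n * (x * x + t)                 ∎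
  where
  open ≤-Reasoning
  x = a zero
  s = ∑[ i < n ] a (suc i)
  t = ∑[ i < n ] (a (suc i) * a (suc i))
  square : ∀ x s → (x + s) * (x + s) ≡ x * x + 2 * x * s + s * s
  square = solve-∀
  collect : ∀ n x t → x * x + (n * (x * x) + t) + n * t ≡ suc n * (x * x + t)
  collect = solve-∀
  -- Induction in both arguments avoids truncated subtraction: raising `x` and `y` by one adds
  -- `2 + 2 * x + 2 * y` to either side.
  am-gm : ∀ x y → 2 * x * y ≤ x * x + y * y
  am-gm zero y = z≤n
  am-gm (suc x) zero = ≤-trans (≤-reflexive (*-zeroʳ (2 * suc x))) z≤n
  am-gm (suc x) (suc y) = begin
    2 * suc x * suc y                  ≡⟨ e₁ x y ⟩
    2 * x * y + (2 + 2 * x + 2 * y)    ≤⟨ +-monoˡ-≤ _ (am-gm x y) ⟩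
    x * x + y * y + (2 + 2 * x + 2 * y) ≡⟨ e₂ x y ⟩
    suc x * suc x + suc y * suc y      ∎
    where
    e₁ : ∀ x y → 2 * suc x * suc y ≡ 2 * x * y + (2 + 2 * x + 2 * y)
    e₁ = solve-∀
    e₂ : ∀ x y → x * x + y * y + (2 + 2 * x + 2 * y) ≡ suc x * suc x + suc y * suc y
    e₂ = solve-∀
  mixed : ∀ n (b : Fin n → ℕ) →
    2 * x * ∑[ i < n ] b i ≤ n * (x * x) + ∑[ i < n ] (b i * b i)
  mixed zero b = ≤-reflexive (*-zeroʳ (2 * x))
  mixed (suc n) b = begin
    2 * x * (b₀ + r)                          ≡⟨ *-distribˡ-+ (2 * x) b₀ r ⟩
    2 * x * b₀ + 2 * x * r                    ≤⟨ +-mono-≤ (am-gm x b₀) (mixed n (b ∘ suc)) ⟩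
    x * x + b₀ * b₀ + (n * (x * x) + u)       ≡⟨ +-assoc (x * x) _ _ ⟩
    x * x + (b₀ * b₀ + (n * (x * x) + u))     ≡⟨ cong (λ s → x * x + s) (shuffle (b₀ * b₀) (n * (x * x)) u) ⟩
    x * x + (n * (x * x) + (b₀ * b₀ + u))     ≡⟨ +-assoc (x * x) _ _ ⟨
    x * x + n * (x * x) + (b₀ * b₀ + u)       ∎
    where
    b₀ = b zero
    r = ∑[ i < n ] b (suc i)
    u = ∑[ i < n ] (b (suc i) * b (suc i))
    shuffle : ∀ a b c → a + (b + c) ≡ b + (a + c)
    shuffle = solve-∀

-- Sums over all subsets and the collision bound.

-- Recursion on the first position makes splitting along `++` and reindexing by `∁` plain
-- inductions; `sum-subsets` ties this sum to an explicit list.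
∑⊆ : ∀ n → (Subset n → ℕ) → ℕ
∑⊆ zero    g = g []
∑⊆ (suc n) g = ∑⊆ n (g ∘ (inside ∷_)) + ∑⊆ n (g ∘ (outside ∷_))

∑⊆-cong : ∀ n {f g : Subset n → ℕ} → (∀ X → f X ≡ g X) → ∑⊆ n f ≡ ∑⊆ n g
∑⊆-cong zero    f≡g = f≡g []
∑⊆-cong (suc n) f≡g = cong₂ _+_ (∑⊆-cong n (f≡g ∘ (inside ∷_))) (∑⊆-cong n (f≡g ∘ (outside ∷_)))

∑⊆-mono : ∀ n {f g : Subset n → ℕ} → (∀ X → f X ≤ g X) → ∑⊆ n f ≤ ∑⊆ n g
∑⊆-mono zero    f≤g = f≤g []
∑⊆-mono (suc n) f≤g = +-mono-≤ (∑⊆-mono n (f≤g ∘ (inside ∷_))) (∑⊆-mono n (f≤g ∘ (outside ∷_)))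

∑⊆-*ˡ : ∀ n c (f : Subset n → ℕ) → c * ∑⊆ n f ≡ ∑⊆ n (λ X → c * f X)
∑⊆-*ˡ zero    c f = refl
∑⊆-*ˡ (suc n) c f = trans (*-distribˡ-+ c _ _)
  (cong₂ _+_ (∑⊆-*ˡ n c (f ∘ (inside ∷_))) (∑⊆-*ˡ n c (f ∘ (outside ∷_))))

∑⊆-*ʳ : ∀ n c (f : Subset n → ℕ) → ∑⊆ n f * c ≡ ∑⊆ n (λ X → f X * c)
∑⊆-*ʳ n c f = trans (*-comm _ c) (trans (∑⊆-*ˡ n c f) (∑⊆-cong n λ X → *-comm c (f X)))

∑⊆-∑-comm : ∀ n p (f : Subset n → Fin p → ℕ) →
  ∑⊆ n (λ X → ∑[ j < p ] f X j) ≡ ∑[ j < p ] ∑⊆ n (λ X → f X j)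
∑⊆-∑-comm zero    p f = refl
∑⊆-∑-comm (suc n) p f = trans
  (cong₂ _+_ (∑⊆-∑-comm n p (f ∘ (inside ∷_))) (∑⊆-∑-comm n p (f ∘ (outside ∷_))))
  (sym (∑-distrib-+ {n = p} _ _))

∑⊆-++ : ∀ p q (f : Subset (p + q) → ℕ) → ∑⊆ (p + q) f ≡ ∑⊆ p (λ X → ∑⊆ q (λ Y → f (X ++ Y)))
∑⊆-++ zero    q f = refl
∑⊆-++ (suc p) q f = cong₂ _+_ (∑⊆-++ p q (f ∘ (inside ∷_))) (∑⊆-++ p q (f ∘ (outside ∷_)))

-- Complementation is a bijection: at each position it swaps the two halves of the sum.
∑⊆-∁ : ∀ n (f : Subset n → ℕ) → ∑⊆ n (f ∘ ∁) ≡ ∑⊆ n f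
∑⊆-∁ zero    f = refl
∑⊆-∁ (suc n) f = trans (+-comm (∑⊆ n (f ∘ ∁ ∘ (inside ∷_))) _)
  (cong₂ _+_ (∑⊆-∁ n (f ∘ (inside ∷_))) (∑⊆-∁ n (f ∘ (outside ∷_))))

n+n≡2*n : ∀ n → n + n ≡ 2 * n
n+n≡2*n n = cong (λ x → n + x) (sym (+-identityʳ n))

∑⊆-1 : ∀ n → ∑⊆ n (λ _ → 1) ≡ 2 ^ n
∑⊆-1 zero    = refl
∑⊆-1 (suc n) = trans (cong (λ s → s + s) (∑⊆-1 n)) (n+n≡2*n (2 ^ n))

-- Cauchy–Schwarz applied to the weights w(f = j) of the p fibres of f.
∑⊆-collisions : ∀ n p (w f : Subset n → ℕ) → (∀ X → f X < p) →
  ∑⊆ n w * ∑⊆ n w ≤ p * ∑⊆ n (λ X → ∑⊆ n (λ Y → w X * w Y * δ (f X) (f Y)))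
∑⊆-collisions n p w f f<p = begin
  ∑⊆ n w * ∑⊆ n w                       ≡⟨ cong (λ s → s * s) total ⟩
  (∑[ j < p ] a j) * (∑[ j < p ] a j)   ≤⟨ cauchy-schwarz a ⟩
  p * ∑[ j < p ] (a j * a j)            ≡⟨ cong (p *_) squares ⟩
  p * ∑⊆ n (λ X → ∑⊆ n (λ Y → w X * w Y * δ (f X) (f Y))) ∎
  where
  a : Fin p → ℕ
  a j = ∑⊆ n (λ X → w X * δ (f X) (toℕ j))
  total : ∑⊆ n w ≡ ∑[ j < p ] a j
  total = trans
    (∑⊆-cong n λ X → trans (sym (∑-δ (λ _ → w X) (f<p X))) (∑-cong p λ j → *-comm (δ (f X) (toℕ j)) (w X)))
    (∑⊆-∑-comm n p _)
  factor : ∀ v d v′ d′ → v * d * (v′ * d′) ≡ d * (v * v′ * d′)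
  factor = solve-∀
  δ-sym : ∀ a b → δ a b ≡ δ b a
  δ-sym a b = ≤-antisym (𝟙-mono (a ≟ b) (b ≟ a) sym) (𝟙-mono (b ≟ a) (a ≟ b) sym)
  open ≤-Reasoning
  -- The square of each fibre weight is a double sum over `X` and `Y`. Once the sum over `j` is
  -- moved inside, only `j = f X` survives, which leaves the collision indicator.
  squares : ∑[ j < p ] (a j * a j) ≡ ∑⊆ n (λ X → ∑⊆ n (λ Y → w X * w Y * δ (f X) (f Y)))
  squares = begin-equality
    ∑[ j < p ] (a j * a j)
      ≡⟨ ∑-cong p (λ j → trans (∑⊆-*ʳ n (a j) _) (∑⊆-cong n λ X → ∑⊆-*ˡ n (w X * δ (f X) (toℕ j)) _)) ⟩
    ∑[ j < p ] ∑⊆ n (λ X → ∑⊆ n (λ Y → w X * δ (f X) (toℕ j) * (w Y * δ (f Y) (toℕ j))))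
      ≡⟨ trans (∑⊆-cong n (λ X → ∑⊆-∑-comm n p _)) (∑⊆-∑-comm n p _) ⟨
    ∑⊆ n (λ X → ∑⊆ n (λ Y → ∑[ j < p ] (w X * δ (f X) (toℕ j) * (w Y * δ (f Y) (toℕ j)))))
      ≡⟨ ∑⊆-cong n (λ X → ∑⊆-cong n (λ Y → trans
           (∑-cong p λ j → factor (w X) (δ (f X) (toℕ j)) (w Y) (δ (f Y) (toℕ j)))
           (trans (∑-δ (λ j → w X * w Y * δ (f Y) j) (f<p X))
                  (cong (w X * w Y *_) (δ-sym (f Y) (f X)))))) ⟩
    ∑⊆ n (λ X → ∑⊆ n (λ Y → w X * w Y * δ (f X) (f Y))) ∎

-- Listing subsets and pairs of subsets, and counting by filters.

subsets : ∀ n → List (Subset n)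
subsets zero    = [] ∷ []
subsets (suc n) = List.map (inside ∷_) (subsets n) List.++ List.map (outside ∷_) (subsets n)

∈-subsets : ∀ (X : Subset n) → X ∈ₗ subsets n
∈-subsets []            = here refl
∈-subsets (inside ∷ X)  = ∈-++⁺ˡ (∈-map⁺ _ (∈-subsets X))
∈-subsets (outside ∷ X) = ∈-++⁺ʳ (List.map (inside ∷_) (subsets _)) (∈-map⁺ _ (∈-subsets X))

subsets-unique : ∀ n → Unique (subsets n)
subsets-unique zero    = All.[] AllPairs.∷ AllPairs.[]
subsets-unique (suc n) = ++⁺
  (map⁺ (proj₂ ∘ ∷-injective) (subsets-unique n))
  (map⁺ (proj₂ ∘ ∷-injective) (subsets-unique n))
  λ (∈in , ∈out) → disjoint (∈-map⁻ _ ∈in) (∈-map⁻ _ ∈out)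
  where
  disjoint : ∀ {X : Subset (suc n)} →
    ∃ (λ Y → Y ∈ₗ subsets n × X ≡ inside ∷ Y) → ¬ ∃ (λ Y → Y ∈ₗ subsets n × X ≡ outside ∷ Y)
  disjoint (_ , _ , refl) (_ , _ , ())

sum-subsets : ∀ n (f : Subset n → ℕ) → sum (List.map f (subsets n)) ≡ ∑⊆ n f
sum-subsets zero    f = +-identityʳ (f [])
sum-subsets (suc n) f = begin
  sum (List.map f (ins List.++ out))
    ≡⟨ cong sum (map-++ f ins out) ⟩
  sum (List.map f ins List.++ List.map f out)
    ≡⟨ sum-++ (List.map f ins) _ ⟩
  sum (List.map f ins) + sum (List.map f out)
    ≡⟨ cong₂ (λ xs ys → sum xs + sum ys) (map-∘ (subsets n)) (map-∘ (subsets n)) ⟨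
  sum (List.map (f ∘ (inside ∷_)) (subsets n)) + sum (List.map (f ∘ (outside ∷_)) (subsets n))
    ≡⟨ cong₂ _+_ (sum-subsets n _) (sum-subsets n _) ⟩
  ∑⊆ (suc n) f ∎
  where
  open ≡-Reasoning
  ins = List.map (inside ∷_) (subsets n)
  out = List.map (outside ∷_) (subsets n)

module _ {a b} {A : Set a} {B : Set b} where

  sum-cartesianProduct : ∀ (f : A × B → ℕ) xs ys →
    sum (List.map f (cartesianProduct xs ys)) ≡
    sum (List.map (λ x → sum (List.map (λ y → f (x , y)) ys)) xs)
  sum-cartesianProduct f []       ys = refl
  sum-cartesianProduct f (x ∷ xs) ys = begin
    sum (List.map f (List.map (x ,_) ys List.++ cartesianProduct xs ys))
      ≡⟨ cong sum (map-++ f (List.map (x ,_) ys) _) ⟩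
    sum (List.map f (List.map (x ,_) ys) List.++ List.map f (cartesianProduct xs ys))
      ≡⟨ sum-++ (List.map f (List.map (x ,_) ys)) _ ⟩
    sum (List.map f (List.map (x ,_) ys)) + sum (List.map f (cartesianProduct xs ys))
      ≡⟨ cong₂ _+_ (cong sum (map-∘ ys)) (sym (sum-cartesianProduct f xs ys)) ⟨
    _ ∎
    where open ≡-Reasoning

length-filter : ∀ {a p} {A : Set a} {P : Pred A p} (P? : Unary.Decidable P) xs →
  length (filter P? xs) ≡ sum (List.map (λ x → 𝟙 (P? x)) xs)
length-filter P? []       = refl
length-filter P? (x ∷ xs) with does (P? x)
... | true  = cong suc (length-filter P? xs)
... | false = length-filter P? xs

pairs : ∀ p q → List (Subset p × Subset q)
pairs p q = cartesianProduct (subsets p) (subsets q)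

-- Turns the length of a filtered list into a double sum of indicators, the form in which the
-- collision bound delivers its estimate.
length-filter-pairs : ∀ p q {ℓ} {P : Pred (Subset p × Subset q) ℓ} (P? : Unary.Decidable P) →
  length (filter P? (pairs p q)) ≡ ∑⊆ p (λ X → ∑⊆ q (λ Y → 𝟙 (P? (X , Y))))
length-filter-pairs p q P? = begin
  length (filter P? (pairs p q))
    ≡⟨ length-filter P? (pairs p q) ⟩
  sum (List.map (λ x → 𝟙 (P? x)) (pairs p q))
    ≡⟨ sum-cartesianProduct (λ x → 𝟙 (P? x)) (subsets p) (subsets q) ⟩
  _ ≡⟨ sum-subsets p _ ⟩
  _ ≡⟨ ∑⊆-cong p (λ X → sum-subsets q _) ⟩
  _ ∎
  where open ≡-Reasoning

length-pairs : ∀ p q → length (pairs p q) ≡ 2 ^ p * 2 ^ q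
length-pairs p q = trans (length-cartesianProduct (subsets p) (subsets q))
  (cong₂ _*_ (length-subsets p) (length-subsets q))
  where
  length-cartesianProduct : ∀ {a b} {A : Set a} {B : Set b} (xs : List A) (ys : List B) →
    length (cartesianProduct xs ys) ≡ length xs * length ys
  length-cartesianProduct []       ys = refl
  length-cartesianProduct (x ∷ xs) ys = trans (length-++ (List.map (x ,_) ys))
    (cong₂ _+_ (length-map (x ,_) ys) (length-cartesianProduct xs ys))
  length-subsets : ∀ n → length (subsets n) ≡ 2 ^ n
  length-subsets zero    = refl
  length-subsets (suc n) = trans (length-++ (List.map (inside ∷_) (subsets n)))
    (trans (cong₂ _+_ (length-map _ (subsets n)) (length-map _ (subsets n)))
    (trans (cong (λ s → s + s) (length-subsets n)) (n+n≡2*n (2 ^ n))))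

-- Index sums of subsets.

-- The sum of the indices, counted from 0, of the elements. Prepending a position raises each index
-- of the tail by one, hence the summand `∣ X ∣`.
isum : Subset n → ℕ
isum []      = 0
isum (x ∷ X) = ∣ X ∣ + isum X

∣∣-++ : ∀ (X : Subset p) (Y : Subset q) → ∣ X ++ Y ∣ ≡ ∣ X ∣ + ∣ Y ∣
∣∣-++ []            Y = refl
∣∣-++ (inside ∷ X)  Y = cong suc (∣∣-++ X Y)
∣∣-++ (outside ∷ X) Y = ∣∣-++ X Y

∣∁∣ : ∀ (X : Subset n) → ∣ ∁ X ∣ + ∣ X ∣ ≡ n
∣∁∣ []            = refl
∣∁∣ (inside ∷ X)  = trans (+-suc _ _) (cong suc (∣∁∣ X))
∣∁∣ (outside ∷ X) = cong suc (∣∁∣ X)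

-- Behind `X`, each of the `∣ Y ∣` elements of `Y` has its index raised by `p`.
isum-++ : ∀ (X : Subset p) (Y : Subset q) → isum (X ++ Y) ≡ isum X + (isum Y + p * ∣ Y ∣)
isum-++ []      Y = sym (+-identityʳ (isum Y))
isum-++ {p = suc p} (x ∷ X) Y = trans (cong₂ _+_ (∣∣-++ X Y) (isum-++ X Y))
  (shuffle ∣ X ∣ ∣ Y ∣ (isum X) (isum Y) (p * ∣ Y ∣))
  where
  shuffle : ∀ a b c d e → a + b + (c + (d + e)) ≡ a + c + (d + (b + e))
  shuffle = solve-∀

-- Together `X` and its complement use every index once, so their index sums add up to n(n - 1)/2.
-- Doubling and adding `n` avoids division and subtraction.
isum-∁ : ∀ (X : Subset n) → 2 * (isum (∁ X) + isum X) + n ≡ n * n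
isum-∁ [] = refl
isum-∁ {n = suc n} (x ∷ X) = begin
  2 * (∣ ∁ X ∣ + isum (∁ X) + (∣ X ∣ + isum X)) + suc n
    ≡⟨ split ∣ ∁ X ∣ ∣ X ∣ (isum (∁ X)) (isum X) n ⟩
  2 * (∣ ∁ X ∣ + ∣ X ∣) + (2 * (isum (∁ X) + isum X) + n) + 1
    ≡⟨ cong₂ (λ a b → 2 * a + b + 1) (∣∁∣ X) (isum-∁ X) ⟩
  2 * n + n * n + 1
    ≡⟨ square n ⟩
  suc n * suc n ∎
  where
  open ≡-Reasoning
  split : ∀ a b c d n → 2 * (a + c + (b + d)) + suc n ≡ 2 * (a + b) + (2 * (c + d) + n) + 1
  split = solve-∀
  square : ∀ n → 2 * n + n * n + 1 ≡ suc n * suc n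
  square = solve-∀

-- Supplies the number of possible values of `isum` for the collision bound; a quadratic bound is
-- enough for the order of growth.
isum<1+n² : ∀ (X : Subset n) → isum X < suc (n * n)
isum<1+n² {n} X = s≤s (begin
  isum X                            ≤⟨ m≤n+m (isum X) (isum (∁ X)) ⟩
  isum (∁ X) + isum X               ≤⟨ m≤m+n _ _ ⟩
  2 * (isum (∁ X) + isum X)         ≤⟨ m≤m+n _ n ⟩
  2 * (isum (∁ X) + isum X) + n     ≡⟨ isum-∁ X ⟩
  n * n                             ∎)
  where open ≤-Reasoning

-- Lower and upper bounds for the number of balanced pairs.

-- On `Subset m` the cardinality takes at most `suc m` values. A collision of `X` and `Y` makes
-- `∁ X ++ Y` an m-subset, and since `∁` is a bijection different collisions give different
-- m-subsets.
∑⊆-half : ∀ m → (2 ^ m) * (2 ^ m) ≤ suc m * ∑⊆ (m + m) (λ X → δ ∣ X ∣ m)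
∑⊆-half m = begin
  2 ^ m * 2 ^ m
    ≡⟨ cong₂ _*_ (∑⊆-1 m) (∑⊆-1 m) ⟨
  ∑⊆ m (λ _ → 1) * ∑⊆ m (λ _ → 1)
    ≤⟨ ∑⊆-collisions m (suc m) (λ _ → 1) ∣_∣ (λ X → s≤s (∣p∣≤n X)) ⟩
  suc m * ∑⊆ m (λ X → ∑⊆ m (λ Y → 1 * 1 * δ ∣ X ∣ ∣ Y ∣))
    ≤⟨ *-monoʳ-≤ (suc m) (∑⊆-mono m λ X → ∑⊆-mono m λ Y →
         ≤-trans (≤-reflexive (*-identityˡ (δ ∣ X ∣ ∣ Y ∣)))
           (𝟙-mono (∣ X ∣ ≟ ∣ Y ∣) (∣ ∁ X ++ Y ∣ ≟ m) (balanced X Y))) ⟩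
  suc m * ∑⊆ m (λ X → ∑⊆ m (λ Y → δ ∣ ∁ X ++ Y ∣ m))
    ≡⟨ cong (suc m *_) (trans (∑⊆-++ m m _) (sym (∑⊆-∁ m _))) ⟨
  suc m * ∑⊆ (m + m) (λ X → δ ∣ X ∣ m) ∎
  where
  open ≤-Reasoning
  balanced : ∀ (X Y : Subset m) → ∣ X ∣ ≡ ∣ Y ∣ → ∣ ∁ X ++ Y ∣ ≡ m
  balanced X Y eq = trans (∣∣-++ (∁ X) Y) (trans (cong (λ s → ∣ ∁ X ∣ + s) (sym eq)) (∣∁∣ X))

-- X and Y are the parts of a k-class among the k points on either side of 0. The point 0
-- has index k, so the class has sum 0 when its index sum is k * k.
IsBalanced : ∀ k → Subset k × Subset k → Set
IsBalanced k (X , Y) = ∣ X ++ outside ∷ Y ∣ ≡ k × isum (X ++ outside ∷ Y) ≡ k * k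

isBalanced? : ∀ k → Unary.Decidable (IsBalanced k)
isBalanced? k (X , Y) = (_ ≟ _) ×-dec (_ ≟ _)

balancedPairs : ∀ k → List (Subset k × Subset k)
balancedPairs k = filter (isBalanced? k) (pairs k k)

-- Let k = m + m. As `isum Y` may be replaced by `isum X`, the two parts contribute k(k - 1) to
-- twice the index sum by `isum-∁`. The m elements of `Y` stand behind k + 1 positions, which adds
-- 2m(k + 1) = k(k + 1). The total is 2k².
∁-balanced : ∀ m (X Y : Subset (m + m)) → ∣ X ∣ ≡ m → ∣ Y ∣ ≡ m → isum X ≡ isum Y →
  IsBalanced (m + m) (∁ X , Y)
∁-balanced m X Y ∣X∣ ∣Y∣ eq = card , *-cancelˡ-≡ _ _ 2 (+-cancelʳ-≡ (m + m) _ _ index-sum)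
  where
  open ≡-Reasoning
  ∣∁X∣ : ∣ ∁ X ∣ ≡ m
  ∣∁X∣ = +-cancelʳ-≡ m _ _ (trans (cong (λ s → ∣ ∁ X ∣ + s) (sym ∣X∣)) (∣∁∣ X))
  card : ∣ ∁ X ++ outside ∷ Y ∣ ≡ m + m
  card = trans (∣∣-++ (∁ X) (outside ∷ Y)) (cong₂ _+_ ∣∁X∣ ∣Y∣)
  e₁ : ∀ a b c d → 2 * (a + (d + b + c * d)) + c ≡ 2 * (a + b) + c + 2 * (d + c * d)
  e₁ = solve-∀
  e₂ : ∀ m → (m + m) * (m + m) + 2 * (m + (m + m) * m) ≡ 2 * ((m + m) * (m + m)) + (m + m)
  e₂ = solve-∀
  index-sum : 2 * isum (∁ X ++ outside ∷ Y) + (m + m) ≡ 2 * ((m + m) * (m + m)) + (m + m)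
  index-sum = begin
    2 * isum (∁ X ++ outside ∷ Y) + (m + m)
      ≡⟨ cong (λ s → 2 * s + (m + m)) (isum-++ (∁ X) (outside ∷ Y)) ⟩
    2 * (isum (∁ X) + (∣ Y ∣ + isum Y + (m + m) * ∣ Y ∣)) + (m + m)
      ≡⟨ e₁ (isum (∁ X)) (isum Y) (m + m) ∣ Y ∣ ⟩
    2 * (isum (∁ X) + isum Y) + (m + m) + 2 * (∣ Y ∣ + (m + m) * ∣ Y ∣)
      ≡⟨ cong₂ (λ s t → 2 * (isum (∁ X) + s) + (m + m) + 2 * (t + (m + m) * t)) (sym eq) ∣Y∣ ⟩
    2 * (isum (∁ X) + isum X) + (m + m) + 2 * (m + (m + m) * m)
      ≡⟨ cong (_+ 2 * (m + (m + m) * m)) (isum-∁ X) ⟩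
    (m + m) * (m + m) + 2 * (m + (m + m) * m)
      ≡⟨ e₂ m ⟩
    2 * ((m + m) * (m + m)) + (m + m) ∎

fourth-power : ∀ m → 16 ^ m ≡ (2 ^ m * 2 ^ m) * (2 ^ m * 2 ^ m)
fourth-power m = begin
  16 ^ m                              ≡⟨ ^-*-assoc 2 4 m ⟩
  2 ^ (4 * m)                         ≡⟨ cong (2 ^_) (double-double m) ⟩
  2 ^ ((m + m) + (m + m))             ≡⟨ ^-distribˡ-+-* 2 (m + m) (m + m) ⟩
  2 ^ (m + m) * 2 ^ (m + m)           ≡⟨ cong (λ s → s * s) (^-distribˡ-+-* 2 m m) ⟩
  (2 ^ m * 2 ^ m) * (2 ^ m * 2 ^ m)   ∎
  where
  open ≡-Reasoning
  double-double : ∀ m → 4 * m ≡ (m + m) + (m + m)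
  double-double = solve-∀

module _ (m : ℕ) where
  private
    2m = m + m
    w : Subset 2m → ℕ
    w X = δ ∣ X ∣ m

  -- The weight `w` restricts the collision bound for `isum` to m-subsets, and each such collision
  -- gives the balanced pair `(∁ X , Y)`.
  ∑⊆-half² : ∑⊆ 2m w * ∑⊆ 2m w ≤ suc (2m * 2m) * length (balancedPairs 2m)
  ∑⊆-half² = begin
    ∑⊆ 2m w * ∑⊆ 2m w
      ≤⟨ ∑⊆-collisions 2m (suc (2m * 2m)) w isum isum<1+n² ⟩
    suc (2m * 2m) * ∑⊆ 2m (λ X → ∑⊆ 2m (λ Y → w X * w Y * δ (isum X) (isum Y)))
      ≤⟨ *-monoʳ-≤ (suc (2m * 2m)) (∑⊆-mono 2m λ X → ∑⊆-mono 2m λ Y → pointwise X Y) ⟩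
    suc (2m * 2m) * ∑⊆ 2m (λ X → ∑⊆ 2m (λ Y → 𝟙 (isBalanced? 2m (∁ X , Y))))
      ≡⟨ cong (suc (2m * 2m) *_) (trans (length-filter-pairs 2m 2m (isBalanced? 2m)) (sym (∑⊆-∁ 2m _))) ⟨
    suc (2m * 2m) * length (balancedPairs 2m) ∎
    where
    open ≤-Reasoning
    pointwise : ∀ X Y → w X * w Y * δ (isum X) (isum Y) ≤ 𝟙 (isBalanced? 2m (∁ X , Y))
    pointwise X Y = 𝟙-*-mono (∣ X ∣ ≟ m) (∣ Y ∣ ≟ m) (isum X ≟ isum Y) (isBalanced? 2m (∁ X , Y))
      (∁-balanced m X Y)

  balancedPairs-lower : 16 ^ m ≤ (suc m * suc m) * (suc (2m * 2m) * length (balancedPairs 2m))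
  balancedPairs-lower = begin
    16 ^ m                                               ≡⟨ fourth-power m ⟩
    (2 ^ m * 2 ^ m) * (2 ^ m * 2 ^ m)                    ≤⟨ *-mono-≤ (∑⊆-half m) (∑⊆-half m) ⟩
    (suc m * ∑⊆ 2m w) * (suc m * ∑⊆ 2m w)
      ≡⟨ [m*n]*[o*p]≡[m*o]*[n*p] (suc m) (∑⊆ 2m w) (suc m) (∑⊆ 2m w) ⟩
    (suc m * suc m) * (∑⊆ 2m w * ∑⊆ 2m w)                ≤⟨ *-monoʳ-≤ (suc m * suc m) ∑⊆-half² ⟩
    (suc m * suc m) * (suc (2m * 2m) * length (balancedPairs 2m)) ∎
    where
    open ≤-Reasoning

  -- There are `16 ^ m` pairs in all, and the pair of empty sets is not balanced because `m` is
  -- positive; this makes the inequality strict.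
  balancedPairs-upper : .{{NonZero m}} → length (balancedPairs 2m) < 16 ^ m
  balancedPairs-upper = begin-strict
    length (balancedPairs 2m)            <⟨ filter-notAll (isBalanced? 2m) (pairs 2m 2m)
      (lose (∈-cartesianProduct⁺ (∈-subsets ⊥) (∈-subsets ⊥)) ∅-unbalanced) ⟩
    length (pairs 2m 2m)                 ≡⟨ length-pairs 2m 2m ⟩
    2 ^ 2m * 2 ^ 2m                      ≡⟨ cong (λ s → s * s) (^-distribˡ-+-* 2 m m) ⟩
    (2 ^ m * 2 ^ m) * (2 ^ m * 2 ^ m)    ≡⟨ fourth-power m ⟨
    16 ^ m                               ∎
    where
    open ≤-Reasoning
    ∅-unbalanced : ¬ IsBalanced 2m (⊥ , ⊥)
    ∅-unbalanced (card , _) = ≢-nonZero⁻¹ m (m+n≡0⇒m≡0 m (trans (sym card)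
      (trans (∣∣-++ (⊥ {2m}) (outside ∷ ⊥ {2m})) (cong₂ _+_ (∣⊥∣≡0 2m) (∣⊥∣≡0 2m)))))

-- Integer sums and the variance identity.

∑ᶻ : ∀ n → (Fin n → ℤ) → ℤ
∑ᶻ n f = ℤΣ.sum f

∑ᶻ-cong : ∀ n {f g : Fin n → ℤ} → (∀ i → f i ≡ g i) → ∑ᶻ n f ≡ ∑ᶻ n g
∑ᶻ-cong n = ℤΣ.sum-cong-≋

pos-∑ : ∀ n (f : Fin n → ℕ) → + (∑[ i < n ] f i) ≡ ∑ᶻ n (λ i → + f i)
pos-∑ zero    f = refl
pos-∑ (suc n) f = trans (ℤ.pos-+ (f zero) _) (cong (+ f zero +ᶻ_) (pos-∑ n (f ∘ suc)))

∑ᶻ-product : ∀ n p (f : Fin n → ℤ) (g : Fin p → ℤ) →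
  ∑ᶻ n (λ i → ∑ᶻ p (λ j → f i *ᶻ g j)) ≡ ∑ᶻ n f *ᶻ ∑ᶻ p g
∑ᶻ-product n p f g = trans (∑ᶻ-cong n λ i → sym (ℤΣ.*-distribˡ-sum (f i) g))
  (sym (ℤΣ.*-distribʳ-sum (∑ᶻ p g) f))

∑ᶻ∑ᶻ-+ : ∀ n (f g : Fin n → Fin n → ℤ) →
  ∑ᶻ n (λ i → ∑ᶻ n (λ j → f i j +ᶻ g i j)) ≡
  ∑ᶻ n (λ i → ∑ᶻ n (f i)) +ᶻ ∑ᶻ n (λ i → ∑ᶻ n (g i))
∑ᶻ∑ᶻ-+ n f g = trans (∑ᶻ-cong n λ i → ℤΣ.∑-distrib-+ (f i) (g i))
  (ℤΣ.∑-distrib-+ (λ i → ∑ᶻ n (f i)) (λ i → ∑ᶻ n (g i)))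

-- Counts every unordered pair twice.
spread : ∀ n (α v : Fin n → ℤ) → ℤ
spread n α v = ∑ᶻ n (λ i → ∑ᶻ n (λ j → α i *ᶻ α j *ᶻ ((v i -ᶻ v j) *ᶻ (v i -ᶻ v j))))

-- Expanding `(v i - v j)²`, the two square terms give the same product of sums each, and the mixed
-- terms give minus twice the square of `s`, here moved to the left.
spread-variance : ∀ n (α v : Fin n → ℤ) → let s = ∑ᶻ n (λ i → α i *ᶻ v i) in
  spread n α v +ᶻ + 2 *ᶻ (s *ᶻ s) ≡
  + 2 *ᶻ (∑ᶻ n α *ᶻ ∑ᶻ n (λ i → α i *ᶻ (v i *ᶻ v i)))
spread-variance n α v = begin
  spread n α v +ᶻ + 2 *ᶻ (s *ᶻ s)
    ≡⟨ cong (spread n α v +ᶻ_) cross ⟩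
  spread n α v +ᶻ ∑ᶻ n (λ i → ∑ᶻ n (λ j → + 2 *ᶻ (α i *ᶻ v i) *ᶻ (α j *ᶻ v j)))
    ≡⟨ ∑ᶻ∑ᶻ-+ n _ _ ⟨
  _ ≡⟨ (∑ᶻ-cong n λ i → ∑ᶻ-cong n λ j → expand (α i) (α j) (v i) (v j)) ⟩
  ∑ᶻ n (λ i → ∑ᶻ n (λ j → α i *ᶻ (α j *ᶻ (v j *ᶻ v j)) +ᶻ α i *ᶻ (v i *ᶻ v i) *ᶻ α j))
    ≡⟨ ∑ᶻ∑ᶻ-+ n _ _ ⟩
  _ ≡⟨ cong₂ _+ᶻ_ (∑ᶻ-product n n α (λ j → α j *ᶻ (v j *ᶻ v j))) (∑ᶻ-product n n (λ j → α j *ᶻ (v j *ᶻ v j)) α) ⟩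
  ∑ᶻ n α *ᶻ Q +ᶻ Q *ᶻ ∑ᶻ n α
    ≡⟨ double (∑ᶻ n α) Q ⟩
  + 2 *ᶻ (∑ᶻ n α *ᶻ Q) ∎
  where
  open ≡-Reasoning
  s = ∑ᶻ n (λ i → α i *ᶻ v i)
  Q = ∑ᶻ n (λ i → α i *ᶻ (v i *ᶻ v i))
  cross : + 2 *ᶻ (s *ᶻ s) ≡ ∑ᶻ n (λ i → ∑ᶻ n (λ j → + 2 *ᶻ (α i *ᶻ v i) *ᶻ (α j *ᶻ v j)))
  cross = trans (sym (ℤ.*-assoc (+ 2) s s))
    (trans (cong (_*ᶻ s) (ℤΣ.*-distribˡ-sum (+ 2) (λ i → α i *ᶻ v i)))
    (sym (∑ᶻ-product n n (λ i → + 2 *ᶻ (α i *ᶻ v i)) (λ j → α j *ᶻ v j))))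
  expand : ∀ a b x y → a *ᶻ b *ᶻ ((x -ᶻ y) *ᶻ (x -ᶻ y)) +ᶻ + 2 *ᶻ (a *ᶻ x) *ᶻ (b *ᶻ y) ≡
    a *ᶻ (b *ᶻ (y *ᶻ y)) +ᶻ a *ᶻ (x *ᶻ x) *ᶻ b
  expand = ℤSolver.solve-∀
  double : ∀ a b → a *ᶻ b +ᶻ b *ᶻ a ≡ + 2 *ᶻ (a *ᶻ b)
  double = ℤSolver.solve-∀

-- The edge sum as a sum over ordered pairs.

pos-‖‖² : ∀ x → + ‖ x ‖² ≡ x *ᶻ x
pos-‖‖² x = trans (cong (λ y → + (ℤ.∣ x ∣ * y)) (*-identityʳ ℤ.∣ x ∣)) (square x)
  where
  square : ∀ x → + (ℤ.∣ x ∣ * ℤ.∣ x ∣) ≡ x *ᶻ x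
  square (+ n)    = ℤ.pos-* n n
  square -[1+ n ] = refl

-- One copy of the edge sum covers the pairs i < j; the other, with its summation indices exchanged,
-- covers i > j. Diagonal pairs have distance 0.
edgeSum-double : ∀ (v : Fin n → ℤ) {E : Rel (Fin n) 0ℓ} (E? : Decidable E) → Symmetric E →
  2 * edgeSum v E? ≡ ∑[ i < n ] ∑[ j < n ] (if does (E? i j) then ‖ v i -ᶻ v j ‖² else 0)
edgeSum-double {n} v {E} E? E-sym = begin
  2 * edgeSum v E?
    ≡⟨ cong (λ s → edgeSum v E? + s) (+-identityʳ (edgeSum v E?)) ⟩
  edgeSum v E? + edgeSum v E?
    ≡⟨ cong (λ s → edgeSum v E? + s) (∑-comm h) ⟩
  edgeSum v E? + ∑[ i < n ] ∑[ j < n ] h j i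
    ≡⟨ ∑-distrib-+ {n = n} (λ i → ∑[ j < n ] h i j) (λ i → ∑[ j < n ] h j i) ⟨
  ∑[ i < n ] (∑[ j < n ] h i j + ∑[ j < n ] h j i)
    ≡⟨ ∑-cong n (λ i → trans (sym (∑-distrib-+ {n = n} (h i) (λ j → h j i)))
         (∑-cong n λ j → sym (split i j (i Fin.<? j) (j Fin.<? i) (E? i j) (E? j i)))) ⟩
  _ ∎
  where
  open ≡-Reasoning
  h : Fin n → Fin n → ℕ
  h i j = if does ((i Fin.<? j) ×-dec E? i j) then ‖ v i -ᶻ v j ‖² else 0
  dist-sym : ∀ i j → ‖ v i -ᶻ v j ‖² ≡ ‖ v j -ᶻ v i ‖²
  dist-sym i j = cong (_^ 2) (ℤ.∣i-j∣≡∣j-i∣ (v i) (v j))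
  dist-diag : ∀ i → ‖ v i -ᶻ v i ‖² ≡ 0
  dist-diag i = cong ‖_‖² (ℤ.+-inverseʳ (v i))
  split : ∀ i j (lt? : Dec (i Fin.< j)) (gt? : Dec (j Fin.< i)) (e? : Dec (E i j)) (e′? : Dec (E j i)) →
    (if does e? then ‖ v i -ᶻ v j ‖² else 0) ≡
    (if does (lt? ×-dec e?) then ‖ v i -ᶻ v j ‖² else 0) +
    (if does (gt? ×-dec e′?) then ‖ v j -ᶻ v i ‖² else 0)
  split i j (yes lt) (yes gt) e?      e′?      = ⊥-elim (Fin.<-asym lt gt)
  split i j (yes lt) (no ≯)   e?      e′?      = sym (+-identityʳ _)
  split i j (no ≮)   (yes gt) (yes e) (yes e′) = dist-sym i j
  split i j (no ≮)   (yes gt) (yes e) (no ¬e′) = ⊥-elim (¬e′ (E-sym e))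
  split i j (no ≮)   (yes gt) (no ¬e) (yes e′) = ⊥-elim (¬e (E-sym e′))
  split i j (no ≮)   (yes gt) (no ¬e) (no ¬e′) = refl
  split i j (no ≮)   (no ≯)   e?      e′?      with Fin.<-cmp i j
  ... | tri< lt _ _ = ⊥-elim (≮ lt)
  ... | tri> _ _ gt = ⊥-elim (≯ gt)
  split i i (no ≮)   (no ≯)   (yes e) e′?      | tri≈ _ refl _ = dist-diag i
  split i i (no ≮)   (no ≯)   (no ¬e) e′?      | tri≈ _ refl _ = refl

-- Characteristic functions and sums of indices.

⟦_⟧ : Subset n → Fin n → ℕ
⟦ X ⟧ i = if lookup X i then 1 else 0

∣∣-∑ : ∀ (X : Subset n) → ∣ X ∣ ≡ ∑[ i < n ] ⟦ X ⟧ i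
∣∣-∑ []            = refl
∣∣-∑ (inside ∷ X)  = cong suc (∣∣-∑ X)
∣∣-∑ (outside ∷ X) = ∣∣-∑ X

-- A strict inequality at one index could not be made up for at the others, where `f` never exceeds
-- `g`.
∑-pinch : ∀ {f g : Fin n → ℕ} → (∀ i → f i ≤ g i) →
  ∑[ i < n ] g i ≤ ∑[ i < n ] f i → ∀ i → f i ≡ g i
∑-pinch {suc n} {f} {g} f≤g ∑g≤∑f zero = ≤-antisym (f≤g zero)
  (+-cancelʳ-≤ (∑[ i < n ] f (suc i)) _ _ (≤-trans (+-monoʳ-≤ (g zero) (∑-mono (f≤g ∘ suc))) ∑g≤∑f))
∑-pinch {suc n} {f} {g} f≤g ∑g≤∑f (suc i) = ∑-pinch (f≤g ∘ suc)
  (+-cancelˡ-≤ (f zero) _ _ (≤-trans (+-monoˡ-≤ _ (f≤g zero)) ∑g≤∑f)) i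

∑-one : ∀ n → ∑[ i < n ] 1 ≡ n
∑-one zero    = refl
∑-one (suc n) = cong suc (∑-one n)

∑ᶻ-one : ∀ n → ∑ᶻ n (λ _ → 1ℤ) ≡ + n
∑ᶻ-one n = trans (sym (pos-∑ n (λ _ → 1))) (cong +_ (∑-one n))

shift : ∀ i z → 1ℤ +ᶻ i +ᶻ z ≡ i +ᶻ (1ℤ +ᶻ z)
shift = ℤSolver.solve-∀

-- The arithmetic series, doubled to avoid division. The offset `z` is general because the tail of
-- the sum is the same series with offset `1ℤ +ᶻ z`.
∑ᶻ-indices : ∀ n z → + 2 *ᶻ ∑ᶻ n (λ i → + toℕ i +ᶻ z) ≡ + n *ᶻ (+ n -ᶻ 1ℤ +ᶻ + 2 *ᶻ z)
∑ᶻ-indices zero    z = refl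
∑ᶻ-indices (suc n) z = begin
  + 2 *ᶻ (0ℤ +ᶻ z +ᶻ ∑ᶻ n (λ i → + suc (toℕ i) +ᶻ z))
    ≡⟨ cong (λ s → + 2 *ᶻ (0ℤ +ᶻ z +ᶻ s)) (∑ᶻ-cong n λ i → shift (+ toℕ i) z) ⟩
  + 2 *ᶻ (0ℤ +ᶻ z +ᶻ ∑ᶻ n (λ i → + toℕ i +ᶻ (1ℤ +ᶻ z)))
    ≡⟨ split z _ ⟩
  + 2 *ᶻ z +ᶻ + 2 *ᶻ ∑ᶻ n (λ i → + toℕ i +ᶻ (1ℤ +ᶻ z))
    ≡⟨ cong (+ 2 *ᶻ z +ᶻ_) (∑ᶻ-indices n (1ℤ +ᶻ z)) ⟩
  + 2 *ᶻ z +ᶻ + n *ᶻ (+ n -ᶻ 1ℤ +ᶻ + 2 *ᶻ (1ℤ +ᶻ z))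
    ≡⟨ collect (+ n) z ⟩
  (1ℤ +ᶻ + n) *ᶻ (1ℤ +ᶻ + n -ᶻ 1ℤ +ᶻ + 2 *ᶻ z) ∎
  where
  open ≡-Reasoning
  split : ∀ z s → + 2 *ᶻ (0ℤ +ᶻ z +ᶻ s) ≡ + 2 *ᶻ z +ᶻ + 2 *ᶻ s
  split = ℤSolver.solve-∀
  collect : ∀ n z → + 2 *ᶻ z +ᶻ n *ᶻ (n -ᶻ 1ℤ +ᶻ + 2 *ᶻ (1ℤ +ᶻ z)) ≡
    (1ℤ +ᶻ n) *ᶻ (1ℤ +ᶻ n -ᶻ 1ℤ +ᶻ + 2 *ᶻ z)
  collect = ℤSolver.solve-∀

-- For general z, as the step to the tail shifts the indices by 1.
∑ᶻ-isum : ∀ (X : Subset n) z →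
  ∑ᶻ n (λ i → + ⟦ X ⟧ i *ᶻ (+ toℕ i +ᶻ z)) ≡ + isum X +ᶻ z *ᶻ + ∣ X ∣
∑ᶻ-isum [] z = sym (trans (ℤ.+-identityˡ _) (ℤ.*-zeroʳ z))
∑ᶻ-isum {suc n} (x ∷ X) z = begin
  + ⟦ x ∷ X ⟧ zero *ᶻ (0ℤ +ᶻ z) +ᶻ ∑ᶻ n (λ i → + ⟦ X ⟧ i *ᶻ (+ suc (toℕ i) +ᶻ z))
    ≡⟨ cong (λ s → + ⟦ x ∷ X ⟧ zero *ᶻ (0ℤ +ᶻ z) +ᶻ s)
         (∑ᶻ-cong n λ i → cong (+ ⟦ X ⟧ i *ᶻ_) (shift (+ toℕ i) z)) ⟩
  + ⟦ x ∷ X ⟧ zero *ᶻ (0ℤ +ᶻ z) +ᶻ ∑ᶻ n (λ i → + ⟦ X ⟧ i *ᶻ (+ toℕ i +ᶻ (1ℤ +ᶻ z)))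
    ≡⟨ cong (λ s → + ⟦ x ∷ X ⟧ zero *ᶻ (0ℤ +ᶻ z) +ᶻ s) (∑ᶻ-isum X (1ℤ +ᶻ z)) ⟩
  + ⟦ x ∷ X ⟧ zero *ᶻ (0ℤ +ᶻ z) +ᶻ (+ isum X +ᶻ (1ℤ +ᶻ z) *ᶻ + ∣ X ∣)
    ≡⟨ head x ⟩
  + (∣ X ∣ + isum X) +ᶻ z *ᶻ + ∣ x ∷ X ∣ ∎
  where
  open ≡-Reasoning
  e₁ : ∀ z c s → 1ℤ *ᶻ (0ℤ +ᶻ z) +ᶻ (s +ᶻ (1ℤ +ᶻ z) *ᶻ c) ≡ c +ᶻ s +ᶻ z *ᶻ (1ℤ +ᶻ c)
  e₁ = ℤSolver.solve-∀
  e₀ : ∀ z c s → 0ℤ *ᶻ (0ℤ +ᶻ z) +ᶻ (s +ᶻ (1ℤ +ᶻ z) *ᶻ c) ≡ c +ᶻ s +ᶻ z *ᶻ c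
  e₀ = ℤSolver.solve-∀
  head : ∀ x → + ⟦ x ∷ X ⟧ zero *ᶻ (0ℤ +ᶻ z) +ᶻ (+ isum X +ᶻ (1ℤ +ᶻ z) *ᶻ + ∣ X ∣) ≡
    + (∣ X ∣ + isum X) +ᶻ z *ᶻ + ∣ x ∷ X ∣
  head true  = e₁ z (+ ∣ X ∣) (+ isum X)
  head false = e₀ z (+ ∣ X ∣) (+ isum X)

-- Drawings as colourings of all points.

HasColour : Vec (Subset n) 3 → Fin n → Fin 3 → Set
HasColour A i r = ∀ s → lookup (lookup A s) i ≡ does (s Fin.≟ r)

⟦⟧-empty-∩ : ∀ {X Y : Subset n} i → Empty (X ∩ Y) → ¬ (lookup X i ≡ true × lookup Y i ≡ true)
⟦⟧-empty-∩ {X = X} {Y} i X∩Y=∅ (i∈X , i∈Y) =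
  X∩Y=∅ (i , x∈p∩q⁺ (lookup⇒[]= i X i∈X , lookup⇒[]= i Y i∈Y))

-- One equation per point expresses both that the classes are disjoint and that no point stays free.
Covered : Subset n → Subset n → Subset n → Set
Covered a b c = ∀ i → ⟦ a ⟧ i + (⟦ b ⟧ i + ⟦ c ⟧ i) ≡ 1

-- Disjointness puts each point into at most one class. The class sizes add up to the number of
-- points, so by `∑-pinch` no point is missed.
isDrawing⇒Covered : ∀ {a b c : Subset n} → suc (k + k) ≡ n →
  IsDrawing (1 ∷ k ∷ k ∷ []) (a ∷ b ∷ c ∷ []) → Covered a b c
isDrawing⇒Covered {n} {k} {a} {b} {c} size drawing = ∑-pinch t≤1 1≤t
  where
  open IsDrawing drawing
  t : Fin n → ℕ
  t i = ⟦ a ⟧ i + (⟦ b ⟧ i + ⟦ c ⟧ i)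
  at-most-one : ∀ x y z → ¬ (x ≡ true × y ≡ true) → ¬ (x ≡ true × z ≡ true) → ¬ (y ≡ true × z ≡ true) →
    (if x then 1 else 0) + ((if y then 1 else 0) + (if z then 1 else 0)) ≤ 1
  at-most-one true  true  z     xy xz yz = ⊥-elim (xy (refl , refl))
  at-most-one true  false true  xy xz yz = ⊥-elim (xz (refl , refl))
  at-most-one true  false false xy xz yz = s≤s z≤n
  at-most-one false true  true  xy xz yz = ⊥-elim (yz (refl , refl))
  at-most-one false true  false xy xz yz = s≤s z≤n
  at-most-one false false true  xy xz yz = s≤s z≤n
  at-most-one false false false xy xz yz = z≤n
  t≤1 : ∀ i → t i ≤ 1
  t≤1 i = at-most-one (lookup a i) (lookup b i) (lookup c i)
    (⟦⟧-empty-∩ i (disjoint {0F} {1F} λ ())) (⟦⟧-empty-∩ i (disjoint {0F} {2F} λ ()))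
    (⟦⟧-empty-∩ i (disjoint {1F} {2F} λ ()))
  1≤t : ∑[ i < n ] 1 ≤ ∑[ i < n ] t i
  1≤t = ≤-reflexive (begin
    ∑[ i < n ] 1
      ≡⟨ trans (∑-one n) (sym size) ⟩
    1 + (k + k)
      ≡⟨ cong₂ _+_ (cardinality 0F) (cong₂ _+_ (cardinality 1F) (cardinality 2F)) ⟨
    ∣ a ∣ + (∣ b ∣ + ∣ c ∣)
      ≡⟨ cong₂ _+_ (∣∣-∑ a) (cong₂ _+_ (∣∣-∑ b) (∣∣-∑ c)) ⟩
    _ ≡⟨ cong (λ s → ∑[ i < n ] ⟦ a ⟧ i + s) (∑-distrib-+ {n = n} ⟦ b ⟧ ⟦ c ⟧) ⟨
    _ ≡⟨ ∑-distrib-+ {n = n} ⟦ a ⟧ (λ i → ⟦ b ⟧ i + ⟦ c ⟧ i) ⟨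
    ∑[ i < n ] t i ∎)
    where open ≡-Reasoning

Covered⇒coloured : ∀ {a b c : Subset n} → Covered a b c → ∀ i → ∃ (HasColour (a ∷ b ∷ c ∷ []) i)
Covered⇒coloured {n} {a} {b} {c} covered i =
  decode (lookup a i) (lookup b i) (lookup c i) refl refl refl (covered i)
  where
  decode : ∀ x y z → lookup a i ≡ x → lookup b i ≡ y → lookup c i ≡ z →
    (if x then 1 else 0) + ((if y then 1 else 0) + (if z then 1 else 0)) ≡ 1 → ∃ (HasColour (a ∷ b ∷ c ∷ []) i)
  decode true  false false ea eb ec _ = 0F , λ { 0F → ea ; 1F → eb ; 2F → ec }
  decode false true  false ea eb ec _ = 1F , λ { 0F → ea ; 1F → eb ; 2F → ec }
  decode false false true  ea eb ec _ = 2F , λ { 0F → ea ; 1F → eb ; 2F → ec }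
  decode true  false true  _  _  _  ()
  decode true  true  false _  _  _  ()
  decode true  true  true  _  _  _  ()
  decode false true  true  _  _  _  ()
  decode false false false _  _  _  ()

Adjacent-sym : (A : Vec (Subset n) k) → Symmetric (Adjacent A)
Adjacent-sym A (r , s , r≢s , i∈r , j∈s) = s , r , ≢-sym r≢s , j∈s , i∈r

*ᶻ-distribʳ-+ᶻ₃ : ∀ x y z w → (x +ᶻ y +ᶻ z) *ᶻ w ≡ x *ᶻ w +ᶻ y *ᶻ w +ᶻ z *ᶻ w
*ᶻ-distribʳ-+ᶻ₃ = ℤSolver.solve-∀

-- The energy formula for a coloured point set.

module Coloured {n} (A : Vec (Subset n) 3) (coloured : ∀ i → ∃ (HasColour A i)) (v : Fin n → ℤ) where

  κ : Fin n → Fin 3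
  κ i = proj₁ (coloured i)

  α : Fin 3 → Fin n → ℤ
  α r i = + ⟦ lookup A r ⟧ i

  -- The signed sums of the three classes.
  σ : Fin 3 → ℤ
  σ r = ∑ᶻ n (λ i → α r i *ᶻ v i)

  -- For a singleton class this is the squared norm of its point.
  Q : Fin 3 → ℕ
  Q r = ∑[ i < n ] (⟦ lookup A r ⟧ i * ‖ v i ‖²)

  α≡𝟙 : ∀ r i → α r i ≡ + 𝟙 (r Fin.≟ κ i)
  α≡𝟙 r i = cong (λ x → + (if x then 1 else 0)) (proj₂ (coloured i) r)

  ∑α : ∀ r → ∑ᶻ n (α r) ≡ + ∣ lookup A r ∣
  ∑α r = trans (sym (pos-∑ n ⟦ lookup A r ⟧)) (cong +_ (sym (∣∣-∑ (lookup A r))))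

  α-total : ∀ i → α 0F i +ᶻ α 1F i +ᶻ α 2F i ≡ 1ℤ
  α-total i = trans (cong₂ _+ᶻ_ (cong₂ _+ᶻ_ (α≡𝟙 0F i) (α≡𝟙 1F i)) (α≡𝟙 2F i)) (total (κ i))
    where
    total : ∀ r → + 𝟙 (0F Fin.≟ r) +ᶻ + 𝟙 (1F Fin.≟ r) +ᶻ + 𝟙 (2F Fin.≟ r) ≡ 1ℤ
    total 0F = refl
    total 1F = refl
    total 2F = refl

  class-total : ∀ (f : Fin n → ℤ) →
    ∑ᶻ n (λ i → α 0F i *ᶻ f i) +ᶻ ∑ᶻ n (λ i → α 1F i *ᶻ f i) +ᶻ ∑ᶻ n (λ i → α 2F i *ᶻ f i) ≡ ∑ᶻ n f
  class-total f = begin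
    _ ≡⟨ cong (_+ᶻ ∑ᶻ n (λ i → α 2F i *ᶻ f i)) (ℤΣ.∑-distrib-+ (λ i → α 0F i *ᶻ f i) (λ i → α 1F i *ᶻ f i)) ⟨
    _ ≡⟨ ℤΣ.∑-distrib-+ (λ i → α 0F i *ᶻ f i +ᶻ α 1F i *ᶻ f i) (λ i → α 2F i *ᶻ f i) ⟨
    _ ≡⟨ (∑ᶻ-cong n λ i → trans (sym (*ᶻ-distribʳ-+ᶻ₃ (α 0F i) (α 1F i) (α 2F i) (f i)))
           (trans (cong (_*ᶻ f i) (α-total i)) (ℤ.*-identityˡ (f i)))) ⟩
    ∑ᶻ n f ∎
    where
    open ≡-Reasoning

  pos-Q : ∀ r → + Q r ≡ ∑ᶻ n (λ i → α r i *ᶻ (v i *ᶻ v i))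
  pos-Q r = trans (pos-∑ n (λ i → ⟦ lookup A r ⟧ i * ‖ v i ‖²)) (∑ᶻ-cong n λ i →
    trans (ℤ.pos-* (⟦ lookup A r ⟧ i) ‖ v i ‖²) (cong (α r i *ᶻ_) (pos-‖‖² (v i))))

  pos-normSum : + normSum v ≡ ∑ᶻ n (λ i → v i *ᶻ v i)
  pos-normSum = trans (pos-∑ n (λ i → ‖ v i ‖²)) (∑ᶻ-cong n λ i → pos-‖‖² (v i))

  κ-∈ : ∀ {i r} → i ∈ lookup A r → r ≡ κ i
  κ-∈ {i} {r} i∈r = does-≡ (r Fin.≟ κ i) (trans (sym (proj₂ (coloured i) r)) ([]=⇒lookup i∈r))
    where
    does-≡ : ∀ {x y : Fin 3} (d : Dec (x ≡ y)) → does d ≡ true → x ≡ y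
    does-≡ (yes eq) _ = eq

  ∈-κ : ∀ i → i ∈ lookup A (κ i)
  ∈-κ i = lookup⇒[]= i (lookup A (κ i)) (trans (proj₂ (coloured i) (κ i)) (does-refl (κ i)))
    where
    does-refl : ∀ (r : Fin 3) → does (r Fin.≟ r) ≡ true
    does-refl 0F = refl
    does-refl 1F = refl
    does-refl 2F = refl

  Adjacent⇒≢ : ∀ {i j} → Adjacent A i j → κ i ≢ κ j
  Adjacent⇒≢ (r , s , r≢s , i∈r , j∈s) eq = r≢s (trans (κ-∈ i∈r) (trans eq (sym (κ-∈ j∈s))))

  ≢⇒Adjacent : ∀ {i j} → κ i ≢ κ j → Adjacent A i j
  ≢⇒Adjacent {i} {j} neq = κ i , κ j , neq , ∈-κ i , ∈-κ j

  private
    d : Fin n → Fin n → ℤ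
    d i j = (v i -ᶻ v j) *ᶻ (v i -ᶻ v j)

    -- The indicator of equal colours, written as a sum over the classes so that it matches the
    -- products `α r i *ᶻ α r j` in the three class spreads.
    same : Fin 3 → Fin 3 → ℤ
    same x y = + 𝟙 (0F Fin.≟ x) *ᶻ + 𝟙 (0F Fin.≟ y) +ᶻ + 𝟙 (1F Fin.≟ x) *ᶻ + 𝟙 (1F Fin.≟ y)
      +ᶻ + 𝟙 (2F Fin.≟ x) *ᶻ + 𝟙 (2F Fin.≟ y)

    same-≡ : ∀ x → same x x ≡ 1ℤ
    same-≡ 0F = refl
    same-≡ 1F = refl
    same-≡ 2F = refl

    same-≢ : ∀ x y → x ≢ y → same x y ≡ 0ℤ
    same-≢ 0F 0F neq = ⊥-elim (neq refl)
    same-≢ 0F 1F neq = refl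
    same-≢ 0F 2F neq = refl
    same-≢ 1F 0F neq = refl
    same-≢ 1F 1F neq = ⊥-elim (neq refl)
    same-≢ 1F 2F neq = refl
    same-≢ 2F 0F neq = refl
    same-≢ 2F 1F neq = refl
    same-≢ 2F 2F neq = ⊥-elim (neq refl)

    pair-split : ∀ i j (e? : Dec (Adjacent A i j)) →
      + (if does e? then ‖ v i -ᶻ v j ‖² else 0) +ᶻ same (κ i) (κ j) *ᶻ d i j ≡ 1ℤ *ᶻ 1ℤ *ᶻ d i j
    pair-split i j (yes e) = trans
      (cong₂ (λ x y → x +ᶻ y *ᶻ d i j) (pos-‖‖² (v i -ᶻ v j)) (same-≢ _ _ (Adjacent⇒≢ e)))
      (lemma (d i j))
      where
      lemma : ∀ x → x +ᶻ 0ℤ *ᶻ x ≡ 1ℤ *ᶻ 1ℤ *ᶻ x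
      lemma = ℤSolver.solve-∀
    pair-split i j (no ¬e) with κ i Fin.≟ κ j
    ... | no neq = ⊥-elim (¬e (≢⇒Adjacent neq))
    ... | yes eq = trans (cong (λ y → 0ℤ +ᶻ y *ᶻ d i j) (trans (cong (λ x → same x (κ j)) eq) (same-≡ (κ j))))
      (ℤ.+-identityˡ _)

  -- In a complete multipartite graph an ordered pair of points is either adjacent or inside one
  -- class, so edges and class spreads together exhaust the spread of all points.
  edgeSum-spread :
    + 2 *ᶻ + edgeSum v (adjacent? A) +ᶻ (spread n (α 0F) v +ᶻ spread n (α 1F) v +ᶻ spread n (α 2F) v)
    ≡ spread n (λ _ → 1ℤ) v
  edgeSum-spread = begin
    + 2 *ᶻ + edgeSum v (adjacent? A) +ᶻ (spread n (α 0F) v +ᶻ spread n (α 1F) v +ᶻ spread n (α 2F) v)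
      ≡⟨ cong₂ _+ᶻ_ double spreads ⟩
    ∑ᶻ n (λ i → ∑ᶻ n (λ j → + g i j)) +ᶻ ∑ᶻ n (λ i → ∑ᶻ n (λ j → same (κ i) (κ j) *ᶻ d i j))
      ≡⟨ ∑ᶻ∑ᶻ-+ n _ _ ⟨
    _ ≡⟨ (∑ᶻ-cong n λ i → ∑ᶻ-cong n λ j → pair-split i j (adjacent? A i j)) ⟩
    spread n (λ _ → 1ℤ) v ∎
    where
    open ≡-Reasoning
    g : Fin n → Fin n → ℕ
    g i j = if does (adjacent? A i j) then ‖ v i -ᶻ v j ‖² else 0
    double : + 2 *ᶻ + edgeSum v (adjacent? A) ≡ ∑ᶻ n (λ i → ∑ᶻ n (λ j → + g i j))
    double = trans (sym (ℤ.pos-* 2 (edgeSum v (adjacent? A))))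
      (trans (cong +_ (edgeSum-double v (adjacent? A) (Adjacent-sym A)))
      (trans (pos-∑ n _) (∑ᶻ-cong n λ i → pos-∑ n (g i))))
    spreads : spread n (α 0F) v +ᶻ spread n (α 1F) v +ᶻ spread n (α 2F) v ≡
      ∑ᶻ n (λ i → ∑ᶻ n (λ j → same (κ i) (κ j) *ᶻ d i j))
    spreads = begin
      spread n (α 0F) v +ᶻ spread n (α 1F) v +ᶻ spread n (α 2F) v
        ≡⟨ cong (_+ᶻ spread n (α 2F) v) (∑ᶻ∑ᶻ-+ n _ _) ⟨
      _ ≡⟨ ∑ᶻ∑ᶻ-+ n _ _ ⟨
      _ ≡⟨ (∑ᶻ-cong n λ i → ∑ᶻ-cong n λ j → trans
             (sym (*ᶻ-distribʳ-+ᶻ₃ (α 0F i *ᶻ α 0F j) (α 1F i *ᶻ α 1F j) (α 2F i *ᶻ α 2F j) (d i j)))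
             (cong (_*ᶻ d i j) (cong₂ _+ᶻ_ (cong₂ _+ᶻ_ (products 0F i j) (products 1F i j)) (products 2F i j)))) ⟩
      _ ∎
      where
      products : ∀ r i j → α r i *ᶻ α r j ≡ + 𝟙 (r Fin.≟ κ i) *ᶻ + 𝟙 (r Fin.≟ κ j)
      products r i j = cong₂ _*ᶻ_ (α≡𝟙 r i) (α≡𝟙 r j)

  -- The variance identity evaluates each spread in `edgeSum-spread`; for the whole set the squared
  -- sum vanishes. The coefficient k - 1 of `Q 0F` is split between the two sides to stay within the
  -- natural numbers.
  energy : ∀ k → n ≡ k + suc k → IsDrawing (1 ∷ k ∷ k ∷ []) A → ∑ᶻ n v ≡ 0ℤ →
    edgeSum v (adjacent? A) + Q 0F ≡
    suc k * normSum v + (k * Q 0F + (‖ σ 0F ‖² + (‖ σ 1F ‖² + ‖ σ 2F ‖²)))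
  energy k n≡ drawing ∑v≡0 = ℤ.+-injective (begin
    + (E + Q 0F)
      ≡⟨ ℤ.pos-+ E (Q 0F) ⟩
    + E +ᶻ + Q 0F
      ≡⟨ ℤ.*-cancelˡ-≡ (+ 2) _ _ (eliminate (+ E) (+ Q 0F) (+ Q 1F) (+ Q 2F)
           (σ 0F *ᶻ σ 0F) (σ 1F *ᶻ σ 1F) (σ 2F *ᶻ σ 2F) (+ k)
           {spread n (λ _ → 1ℤ) v} {spread n (α 0F) v} {spread n (α 1F) v} {spread n (α 2F) v}
           edgeSum-spread (variance 0F (cardinality 0F)) (variance 1F (cardinality 1F))
           (variance 2F (cardinality 2F)) total) ⟩
    (1ℤ +ᶻ + k) *ᶻ (+ Q 0F +ᶻ + Q 1F +ᶻ + Q 2F) +ᶻ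
    (+ k *ᶻ + Q 0F +ᶻ (σ 0F *ᶻ σ 0F +ᶻ (σ 1F *ᶻ σ 1F +ᶻ σ 2F *ᶻ σ 2F)))
      ≡⟨ cong₂ _+ᶻ_ (trans (cong ((1ℤ +ᶻ + k) *ᶻ_) (sym normSum-Q)) (sym (ℤ.pos-* (suc k) (normSum v))))
           (cong₂ _+ᶻ_ (sym (ℤ.pos-* k (Q 0F)))
           (cong₂ _+ᶻ_ (sym (pos-‖‖² (σ 0F))) (cong₂ _+ᶻ_ (sym (pos-‖‖² (σ 1F))) (sym (pos-‖‖² (σ 2F)))))) ⟩
    + (suc k * normSum v) +ᶻ (+ (k * Q 0F) +ᶻ (+ ‖ σ 0F ‖² +ᶻ (+ ‖ σ 1F ‖² +ᶻ + ‖ σ 2F ‖²)))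
      ≡⟨⟩
    + (suc k * normSum v + (k * Q 0F + (‖ σ 0F ‖² + (‖ σ 1F ‖² + ‖ σ 2F ‖²)))) ∎)
    where
    open ≡-Reasoning
    open IsDrawing drawing
    E = edgeSum v (adjacent? A)
    variance : ∀ r {s} → ∣ lookup A r ∣ ≡ s → spread n (α r) v +ᶻ + 2 *ᶻ (σ r *ᶻ σ r) ≡ + 2 *ᶻ (+ s *ᶻ + Q r)
    variance r card = trans (spread-variance n (α r) v)
      (cong (+ 2 *ᶻ_) (cong₂ _*ᶻ_ (trans (∑α r) (cong +_ card)) (sym (pos-Q r))))
    normSum-Q : + normSum v ≡ + Q 0F +ᶻ + Q 1F +ᶻ + Q 2F
    normSum-Q = trans pos-normSum (trans (sym (class-total (λ i → v i *ᶻ v i)))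
      (sym (cong₂ _+ᶻ_ (cong₂ _+ᶻ_ (pos-Q 0F) (pos-Q 1F)) (pos-Q 2F))))
    total : spread n (λ _ → 1ℤ) v ≡ + 2 *ᶻ ((+ k +ᶻ (1ℤ +ᶻ + k)) *ᶻ (+ Q 0F +ᶻ + Q 1F +ᶻ + Q 2F))
    total = begin
      spread n (λ _ → 1ℤ) v
        ≡⟨ ℤ.+-identityʳ _ ⟨
      spread n (λ _ → 1ℤ) v +ᶻ + 2 *ᶻ (0ℤ *ᶻ 0ℤ)
        ≡⟨ cong (λ s → spread n (λ _ → 1ℤ) v +ᶻ + 2 *ᶻ (s *ᶻ s))
             (trans (∑ᶻ-cong n λ i → ℤ.*-identityˡ (v i)) ∑v≡0) ⟨
      _ ≡⟨ spread-variance n (λ _ → 1ℤ) v ⟩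
      + 2 *ᶻ (∑ᶻ n (λ _ → 1ℤ) *ᶻ ∑ᶻ n (λ i → 1ℤ *ᶻ (v i *ᶻ v i)))
        ≡⟨ cong (+ 2 *ᶻ_) (cong₂ _*ᶻ_
             (trans (∑ᶻ-one n) (trans (cong +_ n≡) (ℤ.pos-+ k (suc k))))
             (trans (∑ᶻ-cong n λ i → ℤ.*-identityˡ (v i *ᶻ v i)) (trans (sym pos-normSum) normSum-Q))) ⟩
      _ ∎
    -- Linear elimination of the spreads `d`, `d₀`, `d₁`, `d₂`. The common factor 2, from counting
    -- ordered pairs, is cancelled by the caller.
    eliminate : ∀ e q₀ q₁ q₂ t₀ t₁ t₂ k {d d₀ d₁ d₂} →
      + 2 *ᶻ e +ᶻ (d₀ +ᶻ d₁ +ᶻ d₂) ≡ d →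
      d₀ +ᶻ + 2 *ᶻ t₀ ≡ + 2 *ᶻ (1ℤ *ᶻ q₀) →
      d₁ +ᶻ + 2 *ᶻ t₁ ≡ + 2 *ᶻ (k *ᶻ q₁) →
      d₂ +ᶻ + 2 *ᶻ t₂ ≡ + 2 *ᶻ (k *ᶻ q₂) →
      d ≡ + 2 *ᶻ ((k +ᶻ (1ℤ +ᶻ k)) *ᶻ (q₀ +ᶻ q₁ +ᶻ q₂)) →
      + 2 *ᶻ (e +ᶻ q₀) ≡ + 2 *ᶻ ((1ℤ +ᶻ k) *ᶻ (q₀ +ᶻ q₁ +ᶻ q₂) +ᶻ (k *ᶻ q₀ +ᶻ (t₀ +ᶻ (t₁ +ᶻ t₂))))
    eliminate e q₀ q₁ q₂ t₀ t₁ t₂ k {d} {d₀} {d₁} {d₂} h h₀ h₁ h₂ h₃ = begin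
      + 2 *ᶻ (e +ᶻ q₀)
        ≡⟨ e₁ e q₀ d₀ d₁ d₂ t₀ t₁ t₂ ⟩
      (+ 2 *ᶻ e +ᶻ (d₀ +ᶻ d₁ +ᶻ d₂)) -ᶻ ((d₀ +ᶻ + 2 *ᶻ t₀) +ᶻ (d₁ +ᶻ + 2 *ᶻ t₁) +ᶻ (d₂ +ᶻ + 2 *ᶻ t₂))
        +ᶻ + 2 *ᶻ (q₀ +ᶻ (t₀ +ᶻ (t₁ +ᶻ t₂)))
        ≡⟨ cong₂ (λ x y → x -ᶻ y +ᶻ + 2 *ᶻ (q₀ +ᶻ (t₀ +ᶻ (t₁ +ᶻ t₂)))) (trans h h₃) (cong₂ _+ᶻ_ (cong₂ _+ᶻ_ h₀ h₁) h₂) ⟩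
      _ ≡⟨ e₂ q₀ q₁ q₂ t₀ t₁ t₂ k ⟩
      _ ∎
      where
      e₁ : ∀ e q₀ d₀ d₁ d₂ t₀ t₁ t₂ → + 2 *ᶻ (e +ᶻ q₀) ≡
        (+ 2 *ᶻ e +ᶻ (d₀ +ᶻ d₁ +ᶻ d₂)) -ᶻ ((d₀ +ᶻ + 2 *ᶻ t₀) +ᶻ (d₁ +ᶻ + 2 *ᶻ t₁) +ᶻ (d₂ +ᶻ + 2 *ᶻ t₂))
        +ᶻ + 2 *ᶻ (q₀ +ᶻ (t₀ +ᶻ (t₁ +ᶻ t₂)))
      e₁ = ℤSolver.solve-∀
      e₂ : ∀ q₀ q₁ q₂ t₀ t₁ t₂ k →
        + 2 *ᶻ ((k +ᶻ (1ℤ +ᶻ k)) *ᶻ (q₀ +ᶻ q₁ +ᶻ q₂)) -ᶻ (+ 2 *ᶻ (1ℤ *ᶻ q₀) +ᶻ + 2 *ᶻ (k *ᶻ q₁) +ᶻ + 2 *ᶻ (k *ᶻ q₂))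
        +ᶻ + 2 *ᶻ (q₀ +ᶻ (t₀ +ᶻ (t₁ +ᶻ t₂))) ≡
        + 2 *ᶻ ((1ℤ +ᶻ k) *ᶻ (q₀ +ᶻ q₁ +ᶻ q₂) +ᶻ (k *ᶻ q₀ +ᶻ (t₀ +ᶻ (t₁ +ᶻ t₂))))
      e₂ = ℤSolver.solve-∀

-- Colourings with the singleton class in the centre.

opposite : ∀ x z → (if x then 1 else 0) + (if z then 1 else 0) ≡ 1 → z ≡ not x
opposite true  false _ = refl
opposite false true  _ = refl
opposite true  true  ()
opposite false false ()

covered-⊥ : ∀ {b c : Subset n} → Covered ⊥ b c → c ≡ ∁ b
covered-⊥ {b = []}    {[]}    covered = refl
covered-⊥ {b = x ∷ b} {z ∷ c} covered =
  cong₂ _∷_ (opposite x z (covered zero)) (covered-⊥ (covered ∘ suc))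

centre : ∀ p q → Subset (p + suc q)
centre p q = ⊥ {p} ++ inside ∷ ⊥ {q}

-- Off the centre each point lies in exactly one of `b` and `c`, so on both sides `c` is the
-- complement of `b`; at the centre neither class has a point.
covered-centre : ∀ p q {b c : Subset (p + suc q)} → Covered (centre p q) b c →
  ∃₂ λ X Y → b ≡ X ++ outside ∷ Y × c ≡ ∁ X ++ outside ∷ ∁ Y
covered-centre zero q {x ∷ b} {z ∷ c} covered =
  [] , b , cong (_∷ b) (proj₁ (head x z (covered zero))) ,
  cong₂ _∷_ (proj₂ (head x z (covered zero))) (covered-⊥ (covered ∘ suc))
  where
  head : ∀ x z → 1 + ((if x then 1 else 0) + (if z then 1 else 0)) ≡ 1 → x ≡ outside × z ≡ outside
  head false false _ = refl , refl
  head true  _     ()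
  head false true  ()
covered-centre (suc p) q {x ∷ b} {z ∷ c} covered
  with covered-centre p q (covered ∘ suc)
... | X , Y , b≡ , c≡ = x ∷ X , Y , cong (x ∷_) b≡ , cong₂ _∷_ (opposite x z (covered zero)) c≡

centre-covered : ∀ p q (X : Subset p) (Y : Subset q) →
  Covered (centre p q) (X ++ outside ∷ Y) (∁ X ++ outside ∷ ∁ Y)
centre-covered zero    q []      Y       zero    = refl
centre-covered zero    q []      Y       (suc i) = tail Y i
  where
  tail : ∀ {q} (Y : Subset q) → Covered ⊥ Y (∁ Y)
  tail (true  ∷ Y) zero    = refl
  tail (false ∷ Y) zero    = refl
  tail (_ ∷ Y)     (suc i) = tail Y i
centre-covered (suc p) q (true  ∷ X) Y zero    = refl
centre-covered (suc p) q (false ∷ X) Y zero    = refl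
centre-covered (suc p) q (_ ∷ X)     Y (suc i) = centre-covered p q X Y i

lookup-centre : ∀ p q i → lookup (centre p q) i ≡ does (toℕ i ≟ p)
lookup-centre zero    q zero    = refl
lookup-centre zero    q (suc i) = lookup-replicate i outside
lookup-centre (suc p) q zero    = refl
lookup-centre (suc p) q (suc i) = lookup-centre p q i

∣centre∣ : ∀ p q → ∣ centre p q ∣ ≡ 1
∣centre∣ p q = trans (∣∣-++ (⊥ {p}) (inside ∷ ⊥ {q})) (cong₂ (λ x y → x + suc y) (∣⊥∣≡0 p) (∣⊥∣≡0 q))

⟦⟧-injective : ∀ {X Y : Subset n} → (∀ i → ⟦ X ⟧ i ≡ ⟦ Y ⟧ i) → X ≡ Y
⟦⟧-injective {X = []}    {[]}    eq = refl
⟦⟧-injective {X = x ∷ X} {y ∷ Y} eq = cong₂ _∷_ (head x y (eq zero)) (⟦⟧-injective (eq ∘ suc))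
  where
  head : ∀ x y → (if x then 1 else 0) ≡ (if y then 1 else 0) → x ≡ y
  head true  true  _ = refl
  head false false _ = refl
  head true  false ()
  head false true  ()

-- Points placed symmetrically about 0.

-- For `n = 1 + 4 * m` and `k = 2 * m` these are the given `points m`.
offsets : ∀ n k → Fin n → ℤ
offsets n k i = + toℕ i -ᶻ + k

∑ᶻ-offsets : ∀ k → ∑ᶻ (k + suc k) (offsets (k + suc k) k) ≡ 0ℤ
∑ᶻ-offsets k = ℤ.*-cancelˡ-≡ (+ 2) _ 0ℤ (trans (∑ᶻ-indices (k + suc k) (ℤ.- + k))
  (trans (cong (λ n → n *ᶻ (n -ᶻ 1ℤ +ᶻ + 2 *ᶻ (ℤ.- + k))) (ℤ.pos-+ k (suc k))) (vanish (+ k))))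
  where
  vanish : ∀ k → (k +ᶻ (1ℤ +ᶻ k)) *ᶻ ((k +ᶻ (1ℤ +ᶻ k)) -ᶻ 1ℤ +ᶻ + 2 *ᶻ (ℤ.- k)) ≡ + 2 *ᶻ 0ℤ
  vanish = ℤSolver.solve-∀

‖‖²≡0 : ∀ x → ‖ x ‖² ≡ 0 → x ≡ 0ℤ
‖‖²≡0 x eq = ℤ.∣i∣≡0⇒i≡0 (m^n≡0⇒m≡0 ℤ.∣ x ∣ 2 eq)

norm-offset : ∀ (i : Fin n) → ‖ offsets n k i ‖² ≡ 0 → toℕ i ≡ k
norm-offset {k = k} i eq = ℤ.+-injective (ℤ.i-j≡0⇒i≡j (+ toℕ i) (+ k) (‖‖²≡0 _ eq))

∑-≡0 : ∀ {f : Fin n → ℕ} → ∑[ i < n ] f i ≡ 0 → ∀ i → f i ≡ 0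
∑-≡0 {n} {f} ∑f≡0 i = sym (∑-pinch {n} {λ _ → 0} {f} (λ _ → z≤n) (≤-trans (≤-reflexive ∑f≡0) z≤n) i)

-- Energy bound and balanced drawings.

module _ (k : ℕ) where

  private
    N = k + suc k
    v = offsets N k
    sizes : Vec ℕ 3
    sizes = 1 ∷ k ∷ k ∷ []

  class-size : suc (k + k) ≡ N
  class-size = sym (+-suc k k)

  -- The candidate minimizers: the singleton sits at 0, and a pair of subsets, one on each side,
  -- fixes the other two classes.
  drawing : Subset k × Subset k → Vec (Subset N) 3
  drawing (X , Y) = centre k k ∷ (X ++ outside ∷ Y) ∷ (∁ X ++ outside ∷ ∁ Y) ∷ []

  drawing-injective : ∀ {P P′} → drawing P ≡ drawing P′ → P ≡ P′
  drawing-injective {X , Y} {X′ , Y′} eq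
    with ++-injective X X′ (proj₁ (∷-injective (proj₂ (∷-injective eq))))
  ... | refl , refl = refl

  module Balance {a b c : Subset N} (dr : IsDrawing sizes (a ∷ b ∷ c ∷ [])) where

    covered : Covered a b c
    covered = isDrawing⇒Covered {k = k} class-size dr

    open Coloured (a ∷ b ∷ c ∷ []) (Covered⇒coloured covered) v public
    open IsDrawing dr public

    E = edgeSum v (adjacent? (a ∷ b ∷ c ∷ []))
    deviation = ‖ σ 0F ‖² + (‖ σ 1F ‖² + ‖ σ 2F ‖²)

    energy-balance : E + Q 0F ≡ suc k * normSum v + (k * Q 0F + deviation)
    energy-balance = energy k refl dr (∑ᶻ-offsets k)

    -- For `1 ≤ k` the term `Q 0F` on the left of the balance is absorbed by `k * Q 0F`, and the
    -- deviation is a sum of squares.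
    energy-lower : 1 ≤ k → suc k * normSum v ≤ E
    energy-lower 1≤k = +-cancelʳ-≤ (Q 0F) _ _ (begin
      suc k * normSum v + Q 0F
        ≤⟨ +-monoʳ-≤ (suc k * normSum v) (m≤n*m (Q 0F) k {{>-nonZero 1≤k}}) ⟩
      suc k * normSum v + k * Q 0F
        ≤⟨ +-monoʳ-≤ (suc k * normSum v) (m≤m+n (k * Q 0F) deviation) ⟩
      suc k * normSum v + (k * Q 0F + deviation)    ≡⟨ energy-balance ⟨
      E + Q 0F                                      ∎)
      where open ≤-Reasoning

    -- For `2 ≤ k` the net coefficient of `Q 0F` is at least 1, so equality in the energy bound
    -- leaves no room for `Q 0F` or any of the squared signed sums.
    energy-tight : 2 ≤ k → E ≤ suc k * normSum v → Q 0F ≡ 0 × σ 1F ≡ 0ℤ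
    energy-tight 2≤k E≤ = m+n≡0⇒m≡0 (Q 0F) (trans (+-comm (Q 0F) deviation) vanish) ,
      ‖‖²≡0 (σ 1F) (m+n≡0⇒m≡0 ‖ σ 1F ‖² (m+n≡0⇒n≡0 ‖ σ 0F ‖² (m+n≡0⇒m≡0 deviation vanish)))
      where
      open ≤-Reasoning
      vanish : deviation + Q 0F ≡ 0
      vanish = n≤0⇒n≡0 (+-cancelˡ-≤ (suc k * normSum v + Q 0F) _ _ (begin
        suc k * normSum v + Q 0F + (deviation + Q 0F)   ≡⟨ shuffle (suc k * normSum v) (Q 0F) deviation ⟩
        suc k * normSum v + (2 * Q 0F + deviation)
          ≤⟨ +-monoʳ-≤ (suc k * normSum v) (+-monoˡ-≤ deviation (*-monoˡ-≤ (Q 0F) 2≤k)) ⟩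
        suc k * normSum v + (k * Q 0F + deviation)      ≡⟨ energy-balance ⟨
        E + Q 0F                                        ≤⟨ +-monoˡ-≤ (Q 0F) E≤ ⟩
        suc k * normSum v + Q 0F                        ≡⟨ +-identityʳ _ ⟨
        suc k * normSum v + Q 0F + 0                    ∎))
        where
        shuffle : ∀ s q r → s + q + (r + q) ≡ s + (2 * q + r)
        shuffle = solve-∀

    σ₁ : σ 1F ≡ + isum b +ᶻ (ℤ.- + k) *ᶻ + k
    σ₁ = trans (∑ᶻ-isum b (ℤ.- + k)) (cong (λ s → + isum b +ᶻ (ℤ.- + k) *ᶻ + s) (cardinality 1F))

    σ₁≡0⇒isum : σ 1F ≡ 0ℤ → isum b ≡ k * k
    σ₁≡0⇒isum eq = ℤ.+-injective (trans (ℤ.i-j≡0⇒i≡j (+ isum b) (+ k *ᶻ + k)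
      (trans (negate (+ isum b) (+ k)) (trans (sym σ₁) eq)))
      (sym (ℤ.pos-* k k)))
      where
      negate : ∀ s k → s -ᶻ k *ᶻ k ≡ s +ᶻ (ℤ.- k) *ᶻ k
      negate = ℤSolver.solve-∀

    isum⇒σ₁≡0 : isum b ≡ k * k → σ 1F ≡ 0ℤ
    isum⇒σ₁≡0 eq = trans σ₁ (trans
      (cong (λ s → s +ᶻ (ℤ.- + k) *ᶻ + k) (trans (cong +_ eq) (ℤ.pos-* k k))) (cancel (+ k)))
      where
      cancel : ∀ k → k *ᶻ k +ᶻ (ℤ.- k) *ᶻ k ≡ 0ℤ
      cancel = ℤSolver.solve-∀

    -- Every point of `a` has norm 0 and hence index `k`, so `a` is contained in the centre; both
    -- have one element.
    Q₀≡0⇒centre : Q 0F ≡ 0 → a ≡ centre k k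
    Q₀≡0⇒centre Q₀≡0 = ⟦⟧-injective (∑-pinch
      (λ i → below i (lookup a i) refl (∑-≡0 Q₀≡0 i))
      (≤-reflexive (trans (sym (∣∣-∑ (centre k k)))
        (trans (∣centre∣ k k) (trans (sym (cardinality 0F)) (∣∣-∑ a))))))
      where
      𝟙-yes : ∀ {x y} (d : Dec (x ≡ y)) → x ≡ y → does d ≡ true
      𝟙-yes (yes _) _ = refl
      𝟙-yes (no ¬p) p = ⊥-elim (¬p p)
      below : ∀ i x → lookup a i ≡ x → ⟦ a ⟧ i * ‖ v i ‖² ≡ 0 → ⟦ a ⟧ i ≤ ⟦ centre k k ⟧ i
      below i false eq _ = ≤-trans (≤-reflexive (cong (λ x → if x then 1 else 0) eq)) z≤n
      below i true  eq term = ≤-reflexive (cong (λ x → if x then 1 else 0) (trans eq (sym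
        (trans (lookup-centre k k i) (𝟙-yes (toℕ i ≟ k) (norm-offset i
          (trans (sym (*-identityˡ ‖ v i ‖²)) (trans
            (cong (λ x → (if x then 1 else 0) * ‖ v i ‖²) (sym eq)) term))))))))

    balanced-drawing : Q 0F ≡ 0 → σ 1F ≡ 0ℤ → ∃ λ P → IsBalanced k P × (a ∷ b ∷ c ∷ []) ≡ drawing P
    balanced-drawing Q₀≡0 σ₁≡0
      with X , Y , b≡ , c≡ ← covered-centre k k (subst (λ a → Covered a b c) (Q₀≡0⇒centre Q₀≡0) covered)
      = (X , Y) , (trans (cong ∣_∣ (sym b≡)) (cardinality 1F) , trans (cong isum (sym b≡)) (σ₁≡0⇒isum σ₁≡0)) ,
        cong₂ _∷_ (Q₀≡0⇒centre Q₀≡0) (cong₂ (λ b c → b ∷ c ∷ []) b≡ c≡)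

  isDrawing-drawing : ∀ {P} → IsBalanced k P → IsDrawing sizes (drawing P)
  isDrawing-drawing {X , Y} (card , _) = record
    { cardinality = λ { 0F → ∣centre∣ k k ; 1F → card ; 2F → card-∁ }
    -- A point common to two classes would have both as its colour `κ`.
    ; disjoint    = λ {r} {s} r≢s (i , i∈) →
        let i∈r , i∈s = x∈p∩q⁻ (lookup (drawing (X , Y)) r) (lookup (drawing (X , Y)) s) i∈
        in r≢s (trans (κ-∈ {r = r} i∈r) (sym (κ-∈ {r = s} i∈s)))
    }
    where
    open Coloured (drawing (X , Y)) (Covered⇒coloured (centre-covered k k X Y)) v
    ∣X∣+∣Y∣ : ∣ X ∣ + ∣ Y ∣ ≡ k
    ∣X∣+∣Y∣ = trans (sym (∣∣-++ X (outside ∷ Y))) card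
    card-∁ : ∣ ∁ X ++ outside ∷ ∁ Y ∣ ≡ k
    card-∁ = +-cancelʳ-≡ k _ _ (begin
      ∣ ∁ X ++ outside ∷ ∁ Y ∣ + k                   ≡⟨ cong₂ _+_ (∣∣-++ (∁ X) (outside ∷ ∁ Y)) (sym ∣X∣+∣Y∣) ⟩
      (∣ ∁ X ∣ + ∣ ∁ Y ∣) + (∣ X ∣ + ∣ Y ∣)           ≡⟨ shuffle (∣ ∁ X ∣) (∣ ∁ Y ∣) (∣ X ∣) (∣ Y ∣) ⟩
      (∣ ∁ X ∣ + ∣ X ∣) + (∣ ∁ Y ∣ + ∣ Y ∣)           ≡⟨ cong₂ _+_ (∣∁∣ X) (∣∁∣ Y) ⟩
      k + k                                          ∎)
      where
      open ≡-Reasoning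
      shuffle : ∀ a b c d → (a + b) + (c + d) ≡ (a + c) + (b + d)
      shuffle = solve-∀

  -- The singleton at 0 makes `Q 0F` and `σ 0F` vanish, balance makes `σ 1F` vanish, and `σ 2F`
  -- follows since all points together have sum 0.
  drawing-energy : ∀ {P} → IsBalanced k P → edgeSum v (adjacent? (drawing P)) ≡ suc k * normSum v
  drawing-energy {P@(X , Y)} balanced = begin
    E                                              ≡⟨ +-identityʳ E ⟨
    E + 0                                          ≡⟨ cong (λ q → E + q) Q₀ ⟨
    E + Q 0F                                       ≡⟨ energy-balance ⟩
    suc k * normSum v + (k * Q 0F + deviation)     ≡⟨ cong₂ (λ q r → suc k * normSum v + (k * q + r)) Q₀
      (cong₂ _+_ (cong ‖_‖² σ₀) (cong₂ _+_ (cong ‖_‖² σ₁≡0) (cong ‖_‖² σ₂))) ⟩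
    suc k * normSum v + (k * 0 + 0)
      ≡⟨ cong (λ r → suc k * normSum v + r) (trans (+-identityʳ (k * 0)) (*-zeroʳ k)) ⟩
    suc k * normSum v + 0                          ≡⟨ +-identityʳ _ ⟩
    suc k * normSum v                              ∎
    where
    open ≡-Reasoning
    open Balance {centre k k} {X ++ outside ∷ Y} {∁ X ++ outside ∷ ∁ Y} (isDrawing-drawing balanced)
    at-centre : ∀ i (d : Dec (toℕ i ≡ k)) → + 𝟙 d *ᶻ v i ≡ 0ℤ
    at-centre i (yes eq) = trans (ℤ.*-identityˡ (v i)) (ℤ.i≡j⇒i-j≡0 (cong +_ eq))
    at-centre i (no _)   = refl
    α₀v≡0 : ∀ i → α 0F i *ᶻ v i ≡ 0ℤ
    α₀v≡0 i = trans (cong (λ x → + (if x then 1 else 0) *ᶻ v i) (lookup-centre k k i)) (at-centre i (toℕ i ≟ k))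
    σ₀ : σ 0F ≡ 0ℤ
    σ₀ = trans (∑ᶻ-cong N α₀v≡0) (ℤΣ.sum-replicate-zero N)
    Q₀ : Q 0F ≡ 0
    Q₀ = ℤ.+-injective (trans (pos-Q 0F) (trans
      (∑ᶻ-cong N λ i → trans (sym (ℤ.*-assoc (α 0F i) (v i) (v i))) (cong (_*ᶻ v i) (α₀v≡0 i)))
      (ℤΣ.sum-replicate-zero N)))
    σ₁≡0 : σ 1F ≡ 0ℤ
    σ₁≡0 = isum⇒σ₁≡0 (proj₂ balanced)
    σ₂ : σ 2F ≡ 0ℤ
    σ₂ = begin
      σ 2F                       ≡⟨ ℤ.+-identityˡ (σ 2F) ⟨
      0ℤ +ᶻ 0ℤ +ᶻ σ 2F           ≡⟨ cong₂ (λ x y → x +ᶻ y +ᶻ σ 2F) σ₀ σ₁≡0 ⟨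
      σ 0F +ᶻ σ 1F +ᶻ σ 2F       ≡⟨ class-total v ⟩
      ∑ᶻ N v                     ≡⟨ ∑ᶻ-offsets k ⟩
      0ℤ                         ∎

-- Comparing ratios with a common denominator.

/-mono-≤ : ∀ {a b} d .{{_ : NonZero d}} → a ≤ b → + a / d ℚ.≤ + b / d
/-mono-≤ {a} {b} (suc d) a≤b = toℚᵘ-cancel-≤
  (ℚᵘ.≤-respˡ-≃ (ℚᵘ.≃-sym (toℚᵘ-fromℚᵘ (mkℚᵘ (+ a) d)))
  (ℚᵘ.≤-respʳ-≃ (ℚᵘ.≃-sym (toℚᵘ-fromℚᵘ (mkℚᵘ (+ b) d)))
  (*≤* (ℤ.*-monoʳ-≤-nonNeg (+ suc d) (ℤ.+≤+ a≤b)))))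

/-cancel-≤ : ∀ {a b} d .{{_ : NonZero d}} → + a / d ℚ.≤ + b / d → a ≤ b
/-cancel-≤ {a} {b} (suc d) le = ℤ.drop‿+≤+ (ℤ.*-cancelʳ-≤-pos (+ a) (+ b) (+ suc d) (ℚᵘ.drop-*≤*
  (ℚᵘ.≤-respˡ-≃ (toℚᵘ-fromℚᵘ (mkℚᵘ (+ a) d))
  (ℚᵘ.≤-respʳ-≃ (toℚᵘ-fromℚᵘ (mkℚᵘ (+ b) d))
  (toℚᵘ-mono-≤ le)))))

module _ (v : Fin n → ℤ) .{{nz : NonZero (normSum v)}} {E F : Rel (Fin n) 0ℓ}
  (E? : Decidable E) (F? : Decidable F) where

  Λ-mono-≤ : edgeSum v E? ≤ edgeSum v F? → Λ v E? ℚ.≤ Λ v F?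
  Λ-mono-≤ = /-mono-≤ (normSum v)

  Λ-cancel-≤ : Λ v E? ℚ.≤ Λ v F? → edgeSum v E? ≤ edgeSum v F?
  Λ-cancel-≤ = /-cancel-≤ (normSum v)

-- The minimizers are the balanced drawings.

module _ (k : ℕ) .{{nz : NonZero (normSum (offsets (k + suc k) k))}} (2≤k : 2 ≤ k) where

  private
    v = offsets (k + suc k) k
    sizes : Vec ℕ 3
    sizes = 1 ∷ k ∷ k ∷ []

  drawing-minimizes : ∀ {P} → IsBalanced k P → IsMinimizer v sizes (drawing k P)
  drawing-minimizes {P} balanced = record
    { isDrawing = isDrawing-drawing k balanced
    ; minimal   = λ { (a ∷ b ∷ c ∷ []) dr →
        Λ-mono-≤ v (adjacent? (drawing k P)) (adjacent? (a ∷ b ∷ c ∷ [])) (≤-trans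
          (≤-reflexive (drawing-energy k balanced))
          (Balance.energy-lower k dr (≤-trans (s≤s z≤n) 2≤k))) }
    }

  -- The given balanced pair `P₀` shows that the energy bound is attained, so any minimizer attains
  -- it too and `energy-tight` applies.
  minimizer-balanced : ∀ {P₀} → IsBalanced k P₀ → ∀ {a b c} → IsMinimizer v sizes (a ∷ b ∷ c ∷ []) →
    ∃ λ P → IsBalanced k P × (a ∷ b ∷ c ∷ []) ≡ drawing k P
  minimizer-balanced {P₀} balanced₀ {a} {b} {c} min =
    Balance.balanced-drawing k isDrawing (proj₁ tight) (proj₂ tight)
    where
    open IsMinimizer min
    tight = Balance.energy-tight k isDrawing 2≤k (≤-trans
      (Λ-cancel-≤ v (adjacent? (a ∷ b ∷ c ∷ [])) (adjacent? (drawing k P₀))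
        (minimal (drawing k P₀) (isDrawing-drawing k balanced₀)))
      (≤-reflexive (drawing-energy k balanced₀)))

-- Counting the minimizers.

nonempty⇒∈ : ∀ {a} {A : Set a} {xs : List A} → 0 < length xs → ∃ λ x → x ∈ₗ xs
nonempty⇒∈ {xs = x List.∷ xs} _ = x , here refl

∈-balancedPairs⁻ : ∀ k {P} → P ∈ₗ balancedPairs k → IsBalanced k P
∈-balancedPairs⁻ k P∈ = proj₂ (∈-filter⁻ (isBalanced? k) {xs = pairs k k} P∈)

∈-balancedPairs⁺ : ∀ k {P} → IsBalanced k P → P ∈ₗ balancedPairs k
∈-balancedPairs⁺ k {X , Y} = ∈-filter⁺ (isBalanced? k) {xs = pairs k k}
  (∈-cartesianProduct⁺ (∈-subsets X) (∈-subsets Y))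

balancedPairs-unique : ∀ k → Unique (balancedPairs k)
balancedPairs-unique k = filter⁺ (isBalanced? k) (cartesianProduct⁺ (subsets-unique k) (subsets-unique k))

-- The list of balanced pairs, carried over by the injective map `drawing k`, enumerates the
-- minimizers. The equation on `n` admits the size `1 + 4 * m` of the given point set.
minimizers : ∀ k n → n ≡ k + suc k → .{{_ : NonZero (normSum (offsets n k))}} → 2 ≤ k →
  0 < length (balancedPairs k) →
  HasCardinality (IsMinimizer (offsets n k) (1 ∷ k ∷ k ∷ [])) (length (balancedPairs k))
minimizers k n refl {{nz}} 2≤k nonempty =
  List.map (drawing k) (balancedPairs k) ,
  length-map (drawing k) (balancedPairs k) ,
  map⁺ (drawing-injective k) (balancedPairs-unique k) ,
  λ A → mk⇔ (λ A∈ → to (∈-map⁻ (drawing k) A∈)) (from A)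
  where
  to : ∀ {A} → (∃ λ P → P ∈ₗ balancedPairs k × A ≡ drawing k P) → IsMinimizer (offsets n k) (1 ∷ k ∷ k ∷ []) A
  to (P , P∈ , refl) = drawing-minimizes k 2≤k {P} (∈-balancedPairs⁻ k P∈)
  from : ∀ A → IsMinimizer (offsets n k) (1 ∷ k ∷ k ∷ []) A → A ∈ₗ List.map (drawing k) (balancedPairs k)
  from (a ∷ b ∷ c ∷ []) min =
    let P₀ , P₀∈ = nonempty⇒∈ nonempty
        P , balanced , A≡ = minimizer-balanced k 2≤k {P₀} (∈-balancedPairs⁻ k P₀∈) min
    in subst (_∈ₗ List.map (drawing k) (balancedPairs k)) (sym A≡)
         (∈-map⁺ (drawing k) (∈-balancedPairs⁺ k {P} balanced))

-- The numerical constant and the final estimate.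

ratio-< : ∀ X Y d N .{{_ : NonZero Y}} .{{_ : NonZero d}} →
  X < N * (d * Y) → (+ 1 / d) ℚ.* (+ X / Y) ℚ.< + N / 1
ratio-< X (suc Y) (suc d) N lt = toℚᵘ-cancel-<
  (ℚᵘ.<-respˡ-≃ (ℚᵘ.≃-sym (ℚᵘ.≃-trans (toℚᵘ-homo-* (+ 1 / suc d) (+ X / suc Y))
    (ℚᵘ.*-cong (toℚᵘ-fromℚᵘ (mkℚᵘ (+ 1) d)) (toℚᵘ-fromℚᵘ (mkℚᵘ (+ X) Y)))))
  (ℚᵘ.<-respʳ-≃ (ℚᵘ.≃-sym (toℚᵘ-fromℚᵘ (mkℚᵘ (+ N) 0)))
  (*<* (subst₂ ℤ._<_ (sym (trans (ℤ.*-identityʳ _) (ℤ.*-identityˡ (+ X))))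
    (ℤ.pos-* N (suc d * suc Y)) (ℤ.+<+ lt)))))

-- For positive `m`, `suc m ≤ 2 * m` and 4m² + 1 ≤ 5m², so the factor in front of `N` is at most
-- 20m⁴, which is at most 20m⁵.
final-bound : ∀ m N .{{_ : NonZero m}} → 16 ^ m ≤ (suc m * suc m) * (suc (2 * m * (2 * m)) * N) → 0 < N →
  16 ^ m < N * (21 * m ^ 5)
final-bound m N le 0<N = begin-strict
  16 ^ m                                              ≤⟨ le ⟩
  (suc m * suc m) * (suc (2 * m * (2 * m)) * N)       ≤⟨ *-mono-≤ (*-mono-≤ suc≤ suc≤) (*-monoˡ-≤ N suc²≤) ⟩
  (2 * m * (2 * m)) * (5 * (m * m) * N)               ≡⟨ collect m N ⟩
  20 * (m * (m * (m * (m * 1))) * N)                  ≤⟨ *-monoʳ-≤ 20 (*-monoˡ-≤ N (m≤n*m (m ^ 4) m)) ⟩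
  20 * (m ^ 5 * N)
    -- Passing from 20 to 21 makes the inequality strict, since `m ^ 5 * N` is positive; this is the
    -- origin of the constant 1/21.
    <⟨ *-monoˡ-< (m ^ 5 * N) {{m*n≢0 (m ^ 5) N {{m^n≢0 m 5}} {{>-nonZero 0<N}}}} {20} {21} ≤-refl ⟩
  21 * (m ^ 5 * N)                                    ≡⟨ reorder (m ^ 5) N ⟩
  N * (21 * m ^ 5)                                    ∎
  where
  open ≤-Reasoning
  1≤m : 1 ≤ m
  1≤m = n≢0⇒n>0 (≢-nonZero⁻¹ m)
  suc≤ : suc m ≤ 2 * m
  suc≤ = ≤-trans (+-monoˡ-≤ m 1≤m) (≤-reflexive (n+n≡2*n m))
  suc²≤ : suc (2 * m * (2 * m)) ≤ 5 * (m * m)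
  suc²≤ = ≤-trans (+-monoˡ-≤ _ (*-mono-≤ 1≤m 1≤m)) (≤-reflexive (e m))
    where
    e : ∀ m → m * m + 2 * m * (2 * m) ≡ 5 * (m * m)
    e = solve-∀
  collect : ∀ m N → (2 * m * (2 * m)) * (5 * (m * m) * N) ≡ 20 * (m * (m * (m * (m * 1))) * N)
  collect = solve-∀
  reorder : ∀ x N → 21 * (x * N) ≡ N * (21 * x)
  reorder = solve-∀

proposition3 : ∃[ c ] (0ℚ ℚ.< c ×
    (∀ (m : ℕ) .{{_ : NonZero m}} →
    ∃[ N ] (HasCardinality (IsMinimalDrawing m) N ×
    c ℚ.* (_/_ (+ (16 ^ m)) (m ^ 5) {{m^n≢0 m 5}}) ℚ.< + N / 1 ×
    N < 16 ^ m)))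
proposition3 = + 1 / 21 , ℚ.*<* (ℤ.+<+ (s≤s z≤n)) , λ m →
  let k = 2 * m
      k≡ : m + m ≡ k
      k≡ = n+n≡2*n m
      lower = subst (λ k → 16 ^ m ≤ (suc m * suc m) * (suc (k * k) * length (balancedPairs k)))
        k≡ (balancedPairs-lower m)
      upper = subst (λ k → length (balancedPairs k) < 16 ^ m) k≡ (balancedPairs-upper m)
      -- The lower bound with no balanced pair would force `16 ^ m` to be 0.
      nonempty = n≢0⇒n>0 λ N≡0 → ≢-nonZero⁻¹ (16 ^ m) {{m^n≢0 16 m}} (n≤0⇒n≡0 (≤-trans lower (≤-reflexive
        (trans (cong (λ N → (suc m * suc m) * (suc (k * k) * N)) N≡0)
        (trans (cong ((suc m * suc m) *_) (*-zeroʳ (suc (k * k)))) (*-zeroʳ (suc m * suc m)))))))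
  in length (balancedPairs k) ,
     minimizers k (1 + 4 * m) (point-count m) {{normSum-points≢0 m}}
       (*-monoʳ-≤ 2 (n≢0⇒n>0 (≢-nonZero⁻¹ m))) nonempty ,
     ratio-< (16 ^ m) (m ^ 5) 21 (length (balancedPairs k)) {{m^n≢0 m 5}} (final-bound m _ lower nonempty) ,
     upper
  where
  point-count : ∀ m → 1 + 4 * m ≡ 2 * m + suc (2 * m)
  point-count = solve-∀
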